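{- Let $h$ and $k$ be positive integers with $3 \leq h \leq k-1$, and let $A = \{a_1, \ldots, a_k\}$ be a set of positive integers with $a_1 < \cdots < a_k$. If \[|h^{\wedge}_{\pm}A| = 2hk - h^2 + 1,\] then $A = a_1 \ast \{1, 3, \ldots, 2k-1\}$.
   Context: For a finite set $A = \{a_1, \ldots, a_k\}$ of integers (with distinct $a_i$) and a positive integer $h$, the restricted $h$-fold signed sumset is \[h^{\wedge}_{\pm}A = \left\{ \sum_{i=1}^{k} \lambda_i a_i : \lambda_i \in \{ -1,0,1\}, \ \sum_{i=1}^{k} |\lambda_i| = h \right\}.\] For an integer $c$ and a set $S$ of integers, $c \ast S = \{cs : s \in S\}$. -}

module Defs where

open import Data.Nat as ℕ using (ℕ; zero; suc)
open import Data.Integer as ℤ using (ℤ; +_; 0ℤ)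
open import Data.Integer.Properties using (_≟_)
open import Data.List using (List; []; _∷_; map; concatMap; length; filter; deduplicate)
open import Data.Vec using (Vec; []; _∷_)
open import Data.Product using (_×_; _,_; proj₁; proj₂)
open import Relation.Binary.PropositionalEquality using (_≡_)
open import Data.Nat.Properties using () renaming (_≟_ to _≟ℕ_)

data Sign : Set where
  neg zer pos : Sign

signs : List Sign
signs = neg ∷ zer ∷ pos ∷ []

absSign : Sign → ℕ
absSign neg = 1
absSign zer = 0
absSign pos = 1

applySign : Sign → ℤ → ℤ
applySign neg x = ℤ.- x
applySign zer x = 0ℤ
applySign pos x = x

-- All pairs (Σ|λ_i|, Σ λ_i a_i) over all λ ∈ {-1,0,1}^k
weightedSums : ∀ {k} → Vec ℤ k → List (ℕ × ℤ)
weightedSums [] = (0 , 0ℤ) ∷ []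
weightedSums (a ∷ as) =
  concatMap (λ s → map (λ p → (absSign s ℕ.+ proj₁ p , applySign s a ℤ.+ proj₂ p))
                       (weightedSums as))
            signs

restrictedSignedSumList : ∀ {k} → ℕ → Vec ℤ k → List ℤ
restrictedSignedSumList h a = map proj₂ (filter (λ p → proj₁ p ≟ℕ h) (weightedSums a))

restrictedSignedSumsetSize : ∀ {k} → ℕ → Vec ℤ k → ℕ
restrictedSignedSumsetSize h a = length (deduplicate _≟_ (restrictedSignedSumList h a))

{-# OPTIONS --safe #-}
-- Let n = h + 1 and let T be a set of n positive integers.  Shifted by the sum
-- of T, the h-fold signed sums of T are the sums Σ cᵢ aᵢ with cᵢ ∈ {0, 1, 2}
-- and exactly one cᵢ = 1; call this set Y(T).  For b > max T the set
-- Y(b ∷ T) contains Y(T) and 2b + Y(T), hence it has at least one element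
-- outside Y(T) for every class modulo 2b that it meets.  If |T| = n ≥ 3 it meets
-- at least 2n + 1 classes.  To see this divide out common factors 2.  If some
-- a ∈ T has another parity than b, the classes b, b + 2t and a, a + 2t do.
-- Otherwise everything is odd, the residues min (a, b - a) are distinct and
-- below b/2, and they have 2n + 1 subset sums modulo b.  As |Y(T)| ≥ 10 for
-- |T| = 3 unless T = p * {1, 3, 5}, induction on n ≥ 4 gives |Y(T)| > n² unless T
-- is d * {1, 3, …, 2n - 1}.  For h fixed, adjoining a larger b to L adds at least
-- 2h signed sums, ± those in which b replaces one of the h largest elements
-- of L, and one more if L is d * {1, 3, …, 2k - 1} and b ≠ d * (2k + 1).
module Submission where

open import Defs
open import Data.Nat as ℕ
open import Data.Fin using (Fin; toℕ; zero; suc)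
open import Data.List as List using (List; []; _∷_; _++_; length; reverse; deduplicate; applyUpTo; applyDownFrom)
-- Aliases for the ring solver's variable lists, where the overloading of _∷_ is prohibitive.
open import Data.List using () renaming (_∷_ to _◂_; [] to ∙)
open import Data.List.Membership.DecPropositional _≟_ using (_∈?_)
open import Data.List.Membership.Propositional using (_∈_; _∉_)
open import Data.List.Membership.Propositional.Properties using (∈-∃++; ∈-++⁻; ∈-++⁺ˡ; ∈-++⁺ʳ; ∈-concatMap⁺; ∈-map⁺; ∈-filter⁺; ∈-deduplicate⁺)
open import Data.List.Properties using (length-++; length-map; length-applyUpTo; length-applyDownFrom; length-take; length-reverse; take++drop≡id; reverse-applyDownFrom; reverse-involutive; unfold-reverse; ∷-injective)
open import Data.List.Relation.Binary.Permutation.Propositional using (_↭_; refl; prep; swap; trans; ↭-sym; ↭-refl; ↭-trans)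
open import Data.List.Relation.Binary.Permutation.Propositional.Properties using (All-resp-↭; ∈-resp-↭; ↭-length; ↭-reverse; shift)
open import Data.List.Relation.Unary.All as All using (All; []; _∷_)
import Data.List.Relation.Unary.All.Properties as Allₚ
open import Data.List.Relation.Unary.AllPairs as AllPairs using (AllPairs; []; _∷_)
import Data.List.Relation.Unary.AllPairs.Properties as AllPairsₚ
open import Data.List.Relation.Unary.Any using (Any; here; there)
open import Data.List.Relation.Unary.Linked using (Linked; [-]; _∷_)
open import Data.List.Relation.Unary.Linked.Properties using (Linked⇒AllPairs)
open import Data.List.Relation.Unary.Unique.Propositional using (Unique)
open import Data.Nat.Divisibility using (∣⇒≤)
open import Data.Nat.DivMod using (_%_; [m+kn]%n≡m%n; m<n⇒m%n≡m)
open import Data.Nat.Induction using (<-rec)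
open import Data.Nat.ListAction using (sum)
open import Data.Nat.Properties
open import Data.Nat.Tactic.RingSolver using (solve)
open import Data.Product using (Σ; ∃; ∃₂; _×_; _,_; proj₁; proj₂)
open import Data.Sum using (_⊎_; inj₁; inj₂; [_,_]′)
open import Data.Vec as Vec using (Vec; []; _∷_; lookup; map)
import Data.Vec.Properties as Vecₚ
open import Function using (_∘_)
open import Relation.Binary.Definitions using (Total; Transitive; tri<; tri≈; tri>)
open import Relation.Binary.PropositionalEquality as ≡ using (_≡_; _≢_; refl; sym; cong; cong₂; subst; subst₂; ≢-sym; module ≡-Reasoning)
open import Relation.Nullary using (¬_; yes; no; contradiction)
open import Relation.Nullary.Decidable using (True; toWitness)

-- Linear inequalities and lower bounds on cardinalities.

-- Reduces an inequality to an identity for the ring solver: the hypothesis says y - x = (v - u) + c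
-- with slack c ≥ 0.
cancel-< : ∀ {u v} x y c → u < v → x + v + c ≡ y + u → x < y
cancel-< {u} {v} x y c u<v eq = +-cancelʳ-< v x y (begin-strict
  x + v     ≤⟨ m≤m+n (x + v) c ⟩
  x + v + c ≡⟨ eq ⟩
  y + u     <⟨ +-monoʳ-< y u<v ⟩
  y + v     ∎)
  where open ≤-Reasoning

-- Bounds a cardinality from below. With inequality for `R` it counts elements, with incongruence it
-- counts residue classes.
Spread : {A : Set} → (A → A → Set) → (A → Set) → ℕ → Set
Spread {A} R P N = Σ (List A) λ l → AllPairs R l × All P l × N ≤ length l

AtLeast : {A : Set} → (A → Set) → ℕ → Set
AtLeast = Spread _≢_

-- Images arise only inside an existential, so `ρ` records which element an image came from, and
-- separation is asked of `ρ`-related pairs.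
transfer : {A B : Set} {R : A → A → Set} {S : B → B → Set} {P : A → Set} {Q : B → Set}
  (ρ : A → B → Set) →
  (∀ {x} → P x → ∃ λ y → Q y × ρ x y) →
  (∀ {x x′ y y′} → ρ x y → ρ x′ y′ → R x x′ → S y y′) →
  ∀ {N} → Spread R P N → Spread S Q N
transfer {A} {B} {R} {S} {P} {Q} ρ f g (l , r , p , N≤) =
  let l′ , r′ , q , eq , _ = go l r p in l′ , r′ , q , subst (_ ≤_) (sym eq) N≤
  where
  -- The last component carries separation from the tail over to the image of any further element,
  -- in particular of the next head.
  go : ∀ l → AllPairs R l → All P l → ∃ λ l′ → AllPairs S l′ × All Q l′ × length l′ ≡ length l
       × (∀ {x y} → ρ x y → All (R x) l → All (S y) l′)
  go [] [] [] = [] , [] , [] , refl , λ _ _ → []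
  go (x ∷ l) (rx ∷ r) (px ∷ p) =
    let l′ , r′ , q , eq , h = go l r p
        y , qy , ρxy = f px
    in y ∷ l′ , h ρxy rx ∷ r′ , qy ∷ q , cong suc eq ,
       λ { ρ′ (s ∷ ss) → g ρ′ ρxy s ∷ h ρ′ ss }

Unique-length : {A : Set} {xs ys : List A} → Unique xs → All (_∈ ys) xs → length xs ≤ length ys
Unique-length [] [] = z≤n
Unique-length {xs = x ∷ xs} (x∉ ∷ u) (x∈ ∷ all∈) with ∈-∃++ x∈
... | l , r , refl = subst (suc (length xs) ≤_) (sym (↭-length (shift x l r)))
      (s≤s (Unique-length u (All.map drop-x (All.zip (x∉ , all∈)))))
  where
  drop-x : ∀ {y} → x ≢ y × y ∈ l ++ x ∷ r → y ∈ l ++ r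
  drop-x (x≢y , y∈) with ∈-++⁻ l y∈
  ... | inj₁ y∈l          = ∈-++⁺ˡ y∈l
  ... | inj₂ (here y≡x)   = contradiction (sym y≡x) x≢y
  ... | inj₂ (there y∈r)  = ∈-++⁺ʳ l y∈r

-- Subset sums and punctured sums.

data SubsetSum : List ℕ → ℕ → Set where
  []   : SubsetSum [] 0
  skip : ∀ {a L s} → SubsetSum L s → SubsetSum (a ∷ L) s
  take : ∀ {a L s} → SubsetSum L s → SubsetSum (a ∷ L) (a + s)

-- The sums Σ cᵢ aᵢ with cᵢ ∈ {0, 1, 2} and exactly one cᵢ = 1, that is
-- the (|L| - 1)-fold restricted signed sums of L shifted by sum L.
data PuncturedSum : List ℕ → ℕ → Set where
  one  : ∀ {a L s} → SubsetSum L s → PuncturedSum (a ∷ L) (a + 2 * s)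
  omit : ∀ {a L s} → PuncturedSum L s → PuncturedSum (a ∷ L) s
  two  : ∀ {a L s} → PuncturedSum L s → PuncturedSum (a ∷ L) (2 * a + s)

sub-cast : ∀ {L s t} → SubsetSum L s → s ≡ t → SubsetSum L t
sub-cast p refl = p

punctured-cast : ∀ {L s t} → PuncturedSum L s → s ≡ t → PuncturedSum L t
punctured-cast p refl = p

sub-∅ : ∀ L → SubsetSum L 0
sub-∅ []      = []
sub-∅ (a ∷ L) = skip (sub-∅ L)

sub-∈ : ∀ {a L} → a ∈ L → SubsetSum L a
sub-∈ {a} {_ ∷ L} (here refl) = sub-cast (take (sub-∅ L)) (+-identityʳ a)
sub-∈ (there a∈) = skip (sub-∈ a∈)

sub-↭ : ∀ {L L′ s} → L ↭ L′ → SubsetSum L s → SubsetSum L′ s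
sub-↭ refl p = p
sub-↭ (prep x π) (skip p) = skip (sub-↭ π p)
sub-↭ (prep x π) (take p) = take (sub-↭ π p)
sub-↭ (swap x y π) (skip (skip p)) = skip (skip (sub-↭ π p))
sub-↭ (swap x y π) (skip (take p)) = take (skip (sub-↭ π p))
sub-↭ (swap x y π) (take (skip p)) = skip (take (sub-↭ π p))
sub-↭ (swap x y π) (take (take {s = s} p)) =
  sub-cast (take (take (sub-↭ π p))) (solve (x ◂ y ◂ s ◂ ∙))
sub-↭ (trans π π′) p = sub-↭ π′ (sub-↭ π p)

punctured-∈ : ∀ {a L} → a ∈ L → PuncturedSum L a
punctured-∈ {a} {_ ∷ L} (here refl) = punctured-cast (one (sub-∅ L)) (+-identityʳ a)
punctured-∈ (there a∈) = omit (punctured-∈ a∈)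

punctured-pair : ∀ {a t L} → a ∈ L → t ∈ L → a ≢ t → PuncturedSum L (a + 2 * t)
punctured-pair (here refl) (here refl) a≢t = contradiction refl a≢t
punctured-pair (here refl) (there t∈) a≢t = one (sub-∈ t∈)
punctured-pair {a} {t} (there a∈) (here refl) a≢t =
  punctured-cast (two (punctured-∈ a∈)) (+-comm (2 * t) a)
punctured-pair (there a∈) (there t∈) a≢t = omit (punctured-pair a∈ t∈ a≢t)

sub-scale : ∀ d {L s} → SubsetSum L s → SubsetSum (List.map (d *_) L) (d * s)
sub-scale d [] = sub-cast [] (sym (*-zeroʳ d))
sub-scale d (skip p) = skip (sub-scale d p)
sub-scale d (take {a} {s = s} p) =
  sub-cast (take (sub-scale d p)) (solve (d ◂ a ◂ s ◂ ∙))

punctured-scale : ∀ d {L s} → PuncturedSum L s → PuncturedSum (List.map (d *_) L) (d * s)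
punctured-scale d (one {a} {s = s} p) =
  punctured-cast (one (sub-scale d p)) (solve (d ◂ a ◂ s ◂ ∙))
punctured-scale d (omit p) = omit (punctured-scale d p)
punctured-scale d (two {a} {s = s} p) =
  punctured-cast (two (punctured-scale d p)) (solve (d ◂ a ◂ s ◂ ∙))

-- Congruences, and new sums from residue classes.

-- Congruence modulo m without subtraction: multiples of m are added on both sides.
Cong : ℕ → ℕ → ℕ → Set
Cong m x y = ∃₂ λ k l → x + k * m ≡ y + l * m

cong-small : ∀ {m x y} → x < m → y < m → Cong m x y → x ≡ y
cong-small {m} {x} {y} x<m y<m (k , l , eq) = begin
  x               ≡⟨ m<n⇒m%n≡m x<m ⟨
  x % m           ≡⟨ [m+kn]%n≡m%n x k m ⟨
  (x + k * m) % m ≡⟨ cong (_% m) eq ⟩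
  (y + l * m) % m ≡⟨ [m+kn]%n≡m%n y l m ⟩
  y % m           ≡⟨ m<n⇒m%n≡m y<m ⟩
  y               ∎
  where
  open ≡-Reasoning
  instance _ = >-nonZero (m<n⇒0<n x<m)

cong-halve : ∀ c {b s t} → Cong (2 * b) (c + 2 * s) (c + 2 * t) → Cong b s t
cong-halve c {b} {s} {t} (k , l , eq) = k , l ,
  *-cancelˡ-≡ _ _ 2 (+-cancelˡ-≡ c _ _ (begin
    c + 2 * (s + k * b)     ≡⟨ solve (c ◂ s ◂ k ◂ b ◂ ∙) ⟩
    c + 2 * s + k * (2 * b) ≡⟨ eq ⟩
    c + 2 * t + l * (2 * b) ≡⟨ solve (c ◂ t ◂ l ◂ b ◂ ∙) ⟩
    c + 2 * (t + l * b)     ∎))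
  where open ≡-Reasoning

incongruent-small : ∀ {b l} → Unique l → All (_< b) l → AllPairs (λ x y → ¬ Cong b x y) l
incongruent-small [] [] = []
incongruent-small (x∉ ∷ u) (x< ∷ l<) =
  All.map (λ { (x≢y , y<) → x≢y ∘ cong-small x< y< }) (All.zip (x∉ , l<)) ∷ incongruent-small u l<

incongruent-double : ∀ c {b l} → AllPairs (λ x y → ¬ Cong b x y) l →
  AllPairs (λ x y → ¬ Cong (2 * b) x y) (List.map (λ s → c + 2 * s) l)
incongruent-double c p = AllPairsₚ.map⁺ (AllPairs.map (λ n → n ∘ cong-halve c) p)

-- Counts classes modulo 2b met by sums of `b ∷ T` rather than of `T`, so b may carry the
-- coefficient 1.
Residues : ℕ → List ℕ → ℕ → Set
Residues b T = Spread (λ x y → ¬ Cong (2 * b) x y) (PuncturedSum (b ∷ T))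

-- The translates of y by multiples of 2b leave the finite list l at some
-- point, and the last translate in l certifies that the next one is a sum.
escape : ∀ {b T} l → All (PuncturedSum T) l → 0 < b → ∀ {y} → PuncturedSum (b ∷ T) y →
  ∃ λ y′ → (PuncturedSum (b ∷ T) y′ × y′ ∉ l) × ∃ λ k → y′ ≡ y + k * (2 * b)
-- Every translation adds at least 1 and no member of `l` exceeds `sum l`, so this fuel suffices.
escape {b} {T} l ps 0<b {y} py = go (suc (sum l)) y (m≤n+m _ y) py
  where
  ∈⇒≤sum : ∀ {x l} → x ∈ l → x ≤ sum l
  ∈⇒≤sum {l = _ ∷ l} (here refl) = m≤m+n _ (sum l)
  ∈⇒≤sum {l = a ∷ l} (there x∈) = ≤-trans (∈⇒≤sum x∈) (m≤n+m _ a)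
  go : ∀ fuel y → suc (sum l) ≤ y + fuel → PuncturedSum (b ∷ T) y →
    ∃ λ y′ → (PuncturedSum (b ∷ T) y′ × y′ ∉ l) × ∃ λ k → y′ ≡ y + k * (2 * b)
  go zero y bound py =
    y , (py , λ y∈ → <⇒≱ (subst (suc (sum l) ≤_) (+-identityʳ y) bound) (∈⇒≤sum y∈)) ,
    0 , sym (+-identityʳ y)
  go (suc fuel) y bound py with y ∈? l
  ... | no y∉ = y , (py , y∉) , 0 , sym (+-identityʳ y)
  ... | yes y∈ =
    let y′ , q , k , eq = go fuel (2 * b + y)
          (≤-trans (≤-trans bound (≤-reflexive (+-suc y fuel)))
                   (+-monoˡ-≤ fuel (+-monoˡ-≤ y (≤-trans 0<b (m≤m+n b _)))))
          (two (All.lookup ps y∈))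
    in y′ , q , suc k , ≡.trans eq (next y k)
    where
    next : ∀ y k → 2 * b + y + k * (2 * b) ≡ y + suc k * (2 * b)
    next y k = solve (b ◂ y ◂ k ◂ ∙)

-- Each class contributes a sum outside the M given ones. These escaped sums stay in their classes,
-- so they are distinct from each other.
extend : ∀ {b T M N} → 0 < b → AtLeast (PuncturedSum T) M → Residues b T N →
  AtLeast (PuncturedSum (b ∷ T)) (M + N)
extend {b} {T} {M} {N} 0<b (l , u , p , M≤) res
  with transfer {S = _≢_} (λ y y′ → ∃ λ k → y′ ≡ y + k * (2 * b)) (escape l p 0<b)
         (λ { (k , refl) (k′ , refl) ¬c eq → ¬c (k , k′ , eq) }) res
... | l′ , u′ , p′ , N≤ = l ++ l′
  , AllPairsₚ.++⁺ u u′ (All.tabulate λ x∈ → All.map (λ { (_ , y∉) refl → y∉ x∈ }) p′)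
  , Allₚ.++⁺ (All.map omit p) (All.map proj₁ p′)
  , subst (_ ≤_) (sym (length-++ l)) (+-mono-≤ M≤ N≤)

-- Permutations, mixed parities, and subset sums below b/2.

AllPairs-resp-↭ : {A : Set} {R : A → A → Set} → (∀ {x y} → R x y → R y x) →
  ∀ {xs ys} → xs ↭ ys → AllPairs R xs → AllPairs R ys
AllPairs-resp-↭ s refl p = p
AllPairs-resp-↭ s (prep x π) (h ∷ p) = All-resp-↭ π h ∷ AllPairs-resp-↭ s π p
AllPairs-resp-↭ s (swap x y π) ((xy ∷ hx) ∷ hy ∷ p) =
  (s xy ∷ All-resp-↭ π hy) ∷ All-resp-↭ π hx ∷ AllPairs-resp-↭ s π p
AllPairs-resp-↭ s (trans π π′) p = AllPairs-resp-↭ s π′ (AllPairs-resp-↭ s π p)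

∈⇒↭ : ∀ {a : ℕ} {L} → a ∈ L → ∃ λ L′ → L ↭ a ∷ L′
∈⇒↭ {a} a∈ with ∈-∃++ a∈
... | l , r , refl = l ++ r , shift a l r

-- Stated for any total transitive relation, so that it yields minima and maxima alike.
extremum : {R : ℕ → ℕ → Set} → Total R → Transitive R → ∀ x xs →
  ∃₂ λ m r → (x ∷ xs) ↭ m ∷ r × All (R m) r
extremum total tr x [] = x , [] , ↭-refl , []
extremum total tr x (y ∷ ys) with extremum total tr y ys
... | m , r , π , h with total x m
...   | inj₁ xm = x , m ∷ r , prep x π , xm ∷ All.map (tr xm) h
...   | inj₂ mx = m , x ∷ r , trans (prep x π) (swap x m refl) , mx ∷ h

even-or-odd : ∀ n → (∃ λ k → n ≡ 2 * k) ⊎ (∃ λ k → n ≡ suc (2 * k))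
even-or-odd zero = inj₁ (0 , refl)
even-or-odd (suc n) with even-or-odd n
... | inj₁ (k , refl) = inj₂ (k , refl)
... | inj₂ (k , refl) = inj₁ (suc k , cong suc (sym (+-suc k (k + 0))))

cong-parity : ∀ {m} u v → ¬ Cong (2 * m) (2 * u) (suc (2 * v))
cong-parity {m} u v (k , l , eq) = even≢odd (u + k * m) (v + l * m) (begin
  2 * (u + k * m)           ≡⟨ solve (u ◂ k ◂ m ◂ ∙) ⟩
  2 * u + k * (2 * m)       ≡⟨ eq ⟩
  suc (2 * v) + l * (2 * m) ≡⟨ solve (v ◂ l ◂ m ◂ ∙) ⟩
  suc (2 * (v + l * m))     ∎)
  where open ≡-Reasoning

Range : ℕ → ℕ → Set
Range b t = 0 < t × t < b

0∷-unique : ∀ {L} → All (0 <_) L → Unique L → Unique (0 ∷ L)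
0∷-unique 0<L u = All.map <⇒≢ 0<L ∷ u

-- Coefficient 1 on b gives the n + 1 classes b and b + 2t; coefficient 1 on a gives the n classes a
-- and a + 2t with t ≠ a. Inside a family, halving leaves distinct numbers below b; `clash`
-- separates the families.
residues-mixed : ∀ {b a T} → Unique T → All (Range b) T → a ∈ T →
  (∀ s t → ¬ Cong (2 * b) (b + 2 * s) (a + 2 * t)) → Residues b T (suc (2 * length T))
residues-mixed {b} {a} {T} u rng a∈ clash with ∈⇒↭ a∈
... | T′ , π with AllPairs-resp-↭ ≢-sym π u | All-resp-↭ π rng
... | a∉ ∷ u′ | (0<a , a<b) ∷ rng′ =
    List.map (λ s → b + 2 * s) (0 ∷ T) ++ List.map (λ s → a + 2 * s) (0 ∷ T′)
  , AllPairsₚ.++⁺ (classes b u rng) (classes a u′ rng′)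
      (Allₚ.map⁺ {xs = 0 ∷ T} (All.tabulate λ {s} _ → Allₚ.map⁺ {xs = 0 ∷ T′} (All.tabulate λ {t} _ → clash s t)))
  , Allₚ.++⁺ (Allₚ.map⁺ {xs = 0 ∷ T} (one (sub-∅ T) ∷ All.tabulate λ t∈ → one (sub-∈ t∈)))
             (Allₚ.map⁺ {xs = 0 ∷ T′} (omit (punctured-cast (punctured-∈ a∈) (sym (+-identityʳ a))) ∷
                All.tabulate λ t∈ → omit (punctured-pair a∈ (∈-resp-↭ (↭-sym π) (there t∈)) (All.lookup a∉ t∈))))
  , ≤-reflexive (sym size)
  where
  0<b = ≤-trans 0<a (<⇒≤ a<b)
  classes : ∀ c {L} → Unique L → All (Range b) L →
    AllPairs (λ x y → ¬ Cong (2 * b) x y) (List.map (λ s → c + 2 * s) (0 ∷ L))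
  classes c u rng = incongruent-double c
    (incongruent-small (0∷-unique (All.map proj₁ rng) u) (0<b ∷ All.map proj₂ rng))
  size : length (List.map (λ s → b + 2 * s) (0 ∷ T) ++ List.map (λ s → a + 2 * s) (0 ∷ T′)) ≡ suc (2 * length T)
  size = begin
    length (List.map (λ s → b + 2 * s) (0 ∷ T) ++ List.map (λ s → a + 2 * s) (0 ∷ T′))
      ≡⟨ length-++ (List.map (λ s → b + 2 * s) (0 ∷ T)) ⟩
    length (List.map (λ s → b + 2 * s) (0 ∷ T)) + length (List.map (λ s → a + 2 * s) (0 ∷ T′))
      ≡⟨ cong₂ _+_ (length-map _ (0 ∷ T)) (length-map _ (0 ∷ T′)) ⟩
    suc (length T) + suc (length T′)
      ≡⟨ cong (suc (length T) +_) (≡.trans (sym (↭-length π)) (sym (+-identityʳ _))) ⟩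
    suc (2 * length T) ∎
    where open ≡-Reasoning

-- The 2n sums 0, t and m + t, for m the largest element, are distinct.  A further
-- one is x + y, for x the smallest and y the second largest element, unless
-- x + y = m, and then m + x + y = 2m exceeds all the others.
subset-sums : ∀ {b x m y r} → Unique (x ∷ m ∷ y ∷ r) → All (λ t → 0 < t × 2 * t < b) (x ∷ m ∷ y ∷ r) →
  All (x <_) (m ∷ y ∷ r) → All (_< m) (x ∷ y ∷ r) → All (_< y) r →
  Spread (λ s t → ¬ Cong b s t) (SubsetSum (x ∷ m ∷ y ∷ r)) (suc (2 * (3 + length r)))
subset-sums {b} {x} {m} {y} {r} u@(_ ∷ (_ ∷ _)) rng@((0<x , 2x<b) ∷ (0<m , 2m<b) ∷ (0<y , 2y<b) ∷ rng-r)
            (x<m ∷ x<y ∷ x<r) (_ ∷ y<m ∷ r<m) r<y = build extra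
  where
  L = x ∷ m ∷ y ∷ r
  os = x ∷ y ∷ r
  -- All sums considered are bounded by this and lie below b, where incongruence modulo b is mere
  -- inequality.
  half-< : ∀ s t → 2 * s < b → 2 * t < b → s + t < b
  half-< s t p q = *-cancelˡ-< 2 (s + t) b (subst (_< 2 * b) (sym (*-distribˡ-+ 2 s t))
    (subst (2 * s + 2 * t <_) (cong (b +_) (sym (+-identityʳ b))) (+-mono-< p q)))
  base = (0 ∷ L) ++ List.map (m +_) os
  0<os : All (0 <_) os
  0<os = 0<x ∷ 0<y ∷ All.map proj₁ rng-r
  L≤m : All (_≤ m) (0 ∷ L)
  L≤m = z≤n ∷ <⇒≤ x<m ∷ ≤-refl ∷ <⇒≤ y<m ∷ All.map <⇒≤ r<m
  Fresh : ℕ → Set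
  Fresh z = z < b × SubsetSum L z × All (z ≢_) base
  extra : ∃ Fresh
  extra with x + y ≟ m
  -- Elements of r are below y, and m + t exceeds x + y because y < m and x ≤ t.
  ... | no x+y≢m = x + y , half-< x y 2x<b 2y<b
      , sub-cast (take (skip (take (sub-∅ r)))) (cong (x +_) (+-identityʳ y))
      , Allₚ.++⁺ {xs = 0 ∷ L}
          ( >⇒≢ (<-≤-trans 0<x (m≤m+n x y)) ∷ >⇒≢ (m<m+n x 0<y) ∷ x+y≢m ∷ >⇒≢ (m<n+m y 0<x)
          ∷ All.map (λ t<y → >⇒≢ (<-≤-trans t<y (m≤n+m y x))) r<y)
          (Allₚ.map⁺ (All.map (λ {t} x≤t → <⇒≢ (subst (_< m + t) (+-comm y x) (+-mono-<-≤ y<m x≤t)))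
            (≤-refl ∷ <⇒≤ x<y ∷ All.map <⇒≤ x<r)))
  ... | yes x+y≡m = m + (x + y) , subst (λ v → m + v < b) (sym x+y≡m) (half-< m m 2m<b 2m<b)
      , sub-cast (take (take (take (sub-∅ r)))) (solve (x ◂ m ◂ y ◂ ∙))
      , Allₚ.++⁺ {xs = 0 ∷ L}
          (All.map (λ t≤m → >⇒≢ (≤-<-trans t≤m (m<m+n m (<-≤-trans 0<x (m≤m+n x y))))) L≤m)
          (Allₚ.map⁺ (All.map (λ t<m → >⇒≢ (+-monoʳ-< m (subst (_ <_) (sym x+y≡m) t<m)))
            (x<m ∷ y<m ∷ r<m)))
  base-unique : Unique base
  base-unique = AllPairsₚ.++⁺ (0∷-unique (All.map proj₁ rng) u)
    (AllPairsₚ.map⁺ (AllPairs.map (λ s≢t → s≢t ∘ +-cancelˡ-≡ m _ _) (os-unique u)))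
    (All.map (λ t≤m → Allₚ.map⁺ (All.map (λ 0<s → <⇒≢ (≤-<-trans t≤m (m<m+n m 0<s))) 0<os)) L≤m)
    where
    os-unique : Unique L → Unique os
    os-unique ((_ ∷ x∉) ∷ _ ∷ v) = x∉ ∷ v
  base-< : All (_< b) base
  base-< = Allₚ.++⁺ (≤-<-trans z≤n 2m<b ∷ All.map (λ {t} p → ≤-<-trans (m≤m+n t _) (proj₂ p)) rng)
    (Allₚ.map⁺ (All.map (λ {t} → half-< m t 2m<b) (2x<b ∷ 2y<b ∷ All.map proj₂ rng-r)))
  base-sums : All (SubsetSum L) base
  base-sums = Allₚ.++⁺ (sub-∅ L ∷ All.tabulate sub-∈) (Allₚ.map⁺
    (sub-cast (take (take (sub-∅ _))) (solve (x ◂ m ◂ ∙)) ∷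
     All.tabulate {xs = y ∷ r} (λ t∈ → skip (take (sub-∈ t∈)))))
  size : suc (length base) ≡ suc (2 * (3 + length r))
  size = cong suc (≡.trans (length-++ (0 ∷ L) {List.map (m +_) os}) (≡.trans (cong (length (0 ∷ L) +_) (length-map (m +_) os))
    (arith (length r))))
    where
    arith : ∀ n → (4 + n) + (2 + n) ≡ 2 * (3 + n)
    arith n = solve (n ◂ ∙)
  build : ∃ Fresh → Spread (λ s t → ¬ Cong b s t) (SubsetSum L) (suc (2 * (3 + length r)))
  build (z , z<b , zs , fresh) = z ∷ base
    , incongruent-small (fresh ∷ base-unique) (z<b ∷ base-<)
    , zs ∷ base-sums
    , ≤-reflexive (sym size)

-- The smallest and the two largest elements are moved to the front by a permutation, which
-- preserves subset sums.
subset-sums-↭ : ∀ {b} xs → 3 ≤ length xs → Unique xs → All (λ t → 0 < t × 2 * t < b) xs →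
  Spread (λ s t → ¬ Cong b s t) (SubsetSum xs) (suc (2 * length xs))
subset-sums-↭ {b} (x₀ ∷ xs) 3≤ u rng with extremum ≤-total ≤-trans x₀ xs
... | x , [] , π , _ = contradiction (subst (3 ≤_) (↭-length π) 3≤) λ { (s≤s ()) }
... | x , x₁ ∷ xs₁ , π₁ , x≤ with extremum (λ s t → ≤-total t s) (λ p q → ≤-trans q p) x₁ xs₁
... | m , [] , π₂ , _ = contradiction (subst (3 ≤_) (↭-length (↭-trans π₁ (prep x π₂))) 3≤) λ { (s≤s (s≤s ())) }
... | m , x₂ ∷ xs₂ , π₂ , ≤m with extremum (λ s t → ≤-total t s) (λ p q → ≤-trans q p) x₂ xs₂
... | y , r , π₃ , ≤y =
  subst (λ n → Spread (λ s t → ¬ Cong b s t) (SubsetSum (x₀ ∷ xs)) (suc (2 * n))) (sym (↭-length π))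
    (transfer _≡_ (λ p → _ , sub-↭ (↭-sym π) p , refl) (λ { refl refl h → h })
      (sorted (AllPairs-resp-↭ ≢-sym π u) (All-resp-↭ (↭-trans π₂ (prep m π₃)) x≤) (All-resp-↭ π₃ ≤m) ≤y))
  where
  π : (x₀ ∷ xs) ↭ x ∷ m ∷ y ∷ r
  π = ↭-trans π₁ (prep x (↭-trans π₂ (prep m π₃)))
  strict : ∀ {z l} → All (z ≢_) l → All (z ≤_) l → All (z <_) l
  strict p q = All.map (λ { (a , b) → ≤∧≢⇒< b a }) (All.zip (p , q))
  strict′ : ∀ {z l} → All (z ≢_) l → All (_≤ z) l → All (_< z) l
  strict′ p q = All.map (λ { (a , b) → ≤∧≢⇒< b (≢-sym a) }) (All.zip (p , q))
  sorted : Unique (x ∷ m ∷ y ∷ r) → All (x ≤_) (m ∷ y ∷ r) → All (_≤ m) (y ∷ r) → All (_≤ y) r →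
    Spread (λ s t → ¬ Cong b s t) (SubsetSum (x ∷ m ∷ y ∷ r)) (suc (2 * (3 + length r)))
  sorted v@(x∉ ∷ m∉ ∷ y∉ ∷ _) x≤ ≤m ≤y with strict x∉ x≤
  ... | x<m ∷ x<yr = subset-sums v (All-resp-↭ π rng) (x<m ∷ x<yr) (x<m ∷ strict′ m∉ ≤m) (strict′ y∉ ≤y)

-- Residue classes when all elements are odd.

Odd : ℕ → Set
Odd n = ∃ λ k → n ≡ suc (2 * k)

odd+odd≢odd : ∀ {a b c} → Odd a → Odd b → Odd c → a + b ≢ c
odd+odd≢odd (i , refl) (j , refl) (k , refl) eq =
  even≢odd (suc (i + j)) k (≡.trans (sym (sum-of-odds i j)) eq)
  where
  sum-of-odds : ∀ i j → suc (2 * i) + suc (2 * j) ≡ 2 * suc (i + j)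
  sum-of-odds i j = solve (i ◂ j ◂ ∙)

module Fold (b : ℕ) where

  -- For a < b, the distance from a to the nearest multiple of b.
  fold : ℕ → ℕ
  fold a = a ⊓ (b ∸ a)

  fold-cases : ∀ {a} → a < b → fold a ≡ a ⊎ fold a + a ≡ b
  fold-cases {a} a<b with ⊓-sel a (b ∸ a)
  ... | inj₁ eq = inj₁ eq
  ... | inj₂ eq = inj₂ (≡.trans (cong (_+ a) eq) (m∸n+n≡m (<⇒≤ a<b)))

  -- The two candidates a and b - a add up to b, so twice the smaller is at most b; equality would
  -- make b even.
  fold-range : ∀ {a} → Odd b → Range b a → 0 < fold a × 2 * fold a < b
  fold-range {a} (k , refl) (0<a , a<b) = ⊓-glb 0<a (m<n⇒0<n∸m a<b) ,
    ≤∧≢⇒< (begin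
      2 * fold a        ≡⟨ cong (fold a +_) (+-identityʳ _) ⟩
      fold a + fold a   ≤⟨ +-mono-≤ (m⊓n≤m a (b ∸ a)) (m⊓n≤n a (b ∸ a)) ⟩
      a + (b ∸ a)       ≡⟨ m+[n∸m]≡n (<⇒≤ a<b) ⟩
      b                 ∎) (even≢odd (fold a) k)
    where open ≤-Reasoning

  -- Equal folds of different elements would force a + a′ = b, impossible for three odd numbers.
  fold-injective : ∀ {a a′} → Odd b → Odd a → Odd a′ → a < b → a′ < b → fold a ≡ fold a′ → a ≡ a′
  fold-injective {a} {a′} ob oa oa′ a< a′< eq with fold-cases a< | fold-cases a′<
  ... | inj₁ p | inj₁ q = ≡.trans (sym p) (≡.trans eq q)
  ... | inj₁ p | inj₂ q = contradiction (≡.trans (cong (_+ a′) (≡.trans (sym p) eq)) q) (odd+odd≢odd oa oa′ ob)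
  ... | inj₂ p | inj₁ q = contradiction (≡.trans (cong (_+ a) (≡.trans (sym q) (sym eq))) p) (odd+odd≢odd oa′ oa ob)
  ... | inj₂ p | inj₂ q = +-cancelˡ-≡ (fold a) a a′ (≡.trans p (≡.trans (sym q) (cong (_+ a′) (sym eq))))

  fold-unique : ∀ {T} → Odd b → All Odd T → All (_< b) T → Unique T → Unique (List.map fold T)
  fold-unique ob [] [] [] = []
  fold-unique ob (oa ∷ os) (a< ∷ T<) (a∉ ∷ u) =
    Allₚ.map⁺ (All.map (λ { (a≢t , ot , t<) → a≢t ∘ fold-injective ob oa ot a< t< })
      (All.zip (a∉ , All.zip (os , T<)))) ∷ fold-unique ob os T< u

  -- Replacing a by b - a ≡ -a only translates the set of subset sums mod b.
  unfold : ∀ {T} → All (_< b) T → ∃ λ C → ∀ {z} → SubsetSum (List.map fold T) z →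
    ∃ λ w → SubsetSum T w × ∃ λ k → z + C ≡ w + k * b
  unfold [] = 0 , λ { [] → 0 , [] , 0 , refl }
  unfold {a ∷ T} (a< ∷ T<) with unfold T< | fold-cases a<
  ... | C , f | inj₁ eq = C , λ
        { (skip p) → let w , q , k , e = f p in w , skip q , k , e
        ; (take {s = z} p) → let w , q , k , e = f p in a + w , take q , k ,
            (begin
              fold a + z + C    ≡⟨ cong (λ v → v + z + C) eq ⟩
              a + z + C         ≡⟨ +-assoc a z C ⟩
              a + (z + C)       ≡⟨ cong (a +_) e ⟩
              a + (w + k * b)   ≡⟨ +-assoc a w (k * b) ⟨
              a + w + k * b     ∎) }
    where open ≡-Reasoning
  -- The shift collects the elements a replaced by b - a. Omitting b - a matches taking a; taking b
  -- - a matches omitting a, at the cost of one more multiple of b.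
  ... | C , f | inj₂ eq = a + C , λ
        { (skip {s = z} p) → let w , q , k , e = f p in a + w , take q , k ,
            (begin
              z + (a + C)     ≡⟨ shuffle z a C ⟩
              a + (z + C)     ≡⟨ cong (a +_) e ⟩
              a + (w + k * b) ≡⟨ +-assoc a w (k * b) ⟨
              a + w + k * b   ∎)
        ; (take {s = z} p) → let w , q , k , e = f p in w , skip q , suc k ,
            (begin
              fold a + z + (a + C)   ≡⟨ shuffle′ (fold a) z a C ⟩
              fold a + a + (z + C)   ≡⟨ cong₂ _+_ eq e ⟩
              b + (w + k * b)        ≡⟨ shuffle b w (k * b) ⟩
              w + suc k * b          ∎) }
    where
    open ≡-Reasoning
    shuffle : ∀ x y z → x + (y + z) ≡ y + (x + z)
    shuffle x y z = solve (x ◂ y ◂ z ◂ ∙)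
    shuffle′ : ∀ x y z w → x + y + (z + w) ≡ x + z + (y + w)
    shuffle′ x y z w = solve (x ◂ y ◂ z ◂ w ◂ ∙)

-- Subset sums s incongruent modulo b give classes b + 2s distinct modulo 2b. They are counted for
-- the folded set and carried back by `unfold`, whose common shift C cancels from each comparison.
residues-odd : ∀ {b T} → 3 ≤ length T → Unique T → All (Range b) T → Odd b → All Odd T →
  Residues b T (suc (2 * length T))
residues-odd {b} {T} 3≤ u rng ob os =
  let C , f = unfold (All.map proj₂ rng)
      sums = subset-sums-↭ (List.map fold T) (subst (3 ≤_) (sym (length-map fold T)) 3≤)
               (fold-unique ob os (All.map proj₂ rng) u) (Allₚ.map⁺ (All.map (fold-range ob) rng))
      l , inc , p , size = transfer {S = λ s t → ¬ Cong b s t} (λ z w → ∃ λ k → z + C ≡ w + k * b) f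
        (λ { {z} {z′} {w} {w′} (k , e) (k′ , e′) ¬c (i , j , eq) → ¬c (i + k′ , j + k ,
               combine C z z′ w w′ k k′ i j e e′ eq) }) sums
  in List.map (λ s → b + 2 * s) l , incongruent-double b inc , Allₚ.map⁺ (All.map one p) ,
     resize (length-map fold T) (length-map (λ s → b + 2 * s) l) size
  where
  open Fold b
  resize : ∀ {n n′ m m′} → n ≡ n′ → m′ ≡ m → suc (2 * n) ≤ m → suc (2 * n′) ≤ m′
  resize refl refl p = p
  combine : ∀ C z z′ w w′ k k′ i j → z + C ≡ w + k * b → z′ + C ≡ w′ + k′ * b → w + i * b ≡ w′ + j * b →
    z + (i + k′) * b ≡ z′ + (j + k) * b
  combine C z z′ w w′ k k′ i j e e′ eq = +-cancelˡ-≡ C _ _ (begin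
    C + (z + (i + k′) * b)          ≡⟨ solve (C ◂ z ◂ i ◂ k′ ◂ b ◂ ∙) ⟩
    z + C + i * b + k′ * b          ≡⟨ cong (λ v → v + i * b + k′ * b) e ⟩
    w + k * b + i * b + k′ * b      ≡⟨ solve (w ◂ k ◂ i ◂ k′ ◂ b ◂ ∙) ⟩
    w + i * b + k * b + k′ * b      ≡⟨ cong (λ v → v + k * b + k′ * b) eq ⟩
    w′ + j * b + k * b + k′ * b     ≡⟨ solve (w′ ◂ j ◂ k ◂ k′ ◂ b ◂ ∙) ⟩
    w′ + k′ * b + j * b + k * b     ≡⟨ cong (λ v → v + j * b + k * b) e′ ⟨
    z′ + C + j * b + k * b          ≡⟨ solve (C ◂ z′ ◂ j ◂ k ◂ b ◂ ∙) ⟩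
    C + (z′ + (j + k) * b)          ∎)
    where open ≡-Reasoning

-- Descent by removing common factors 2.

Even : ℕ → Set
Even n = ∃ λ k → n ≡ 2 * k

all-or-some : {P Q : ℕ → Set} → (∀ n → P n ⊎ Q n) → ∀ T → All P T ⊎ (∃ λ a → a ∈ T × Q a)
all-or-some dec [] = inj₁ []
all-or-some dec (a ∷ T) with dec a | all-or-some dec T
... | inj₂ q | _                   = inj₂ (a , here refl , q)
... | inj₁ p | inj₁ ps             = inj₁ (p ∷ ps)
... | inj₁ p | inj₂ (x , x∈ , q)   = inj₂ (x , there x∈ , q)

halve-all : ∀ {T} → All Even T → ∃ λ T′ → T ≡ List.map (2 *_) T′
halve-all [] = [] , refl
halve-all ((k , refl) ∷ es) with halve-all es
... | T′ , refl = k ∷ T′ , refl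

-- Strong induction on b. If b and all of T are even, halving preserves the hypotheses and the
-- number of classes, and b decreases, being positive because T is nonempty.
residues : ∀ b T → 3 ≤ length T → Unique T → All (Range b) T → Residues b T (suc (2 * length T))
residues = <-rec _ step
  where
  Goal : ℕ → Set
  Goal b = ∀ T → 3 ≤ length T → Unique T → All (Range b) T → Residues b T (suc (2 * length T))
  step : ∀ b → (∀ {b′} → b′ < b → Goal b′) → Goal b
  step b rec T 3≤ u rng with even-or-odd b
  step b rec T 3≤ u rng | inj₂ ob@(β , refl) with all-or-some ([ inj₂ , inj₁ ]′ ∘ even-or-odd) T
  ... | inj₁ os = residues-odd 3≤ u rng ob os
  -- Here b + 2s is odd and a + 2t is even, while the modulus 2b respects parity.
  ... | inj₂ (_ , a∈ , α , refl) = residues-mixed u rng a∈ λ s t → λ { (k , l , eq) →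
    cong-parity {b} (α + t) (β + s) (l , k , ≡.trans (cong (_+ l * (2 * b)) (*-distribˡ-+ 2 α t))
      (≡.trans (sym eq) (cong (λ v → suc v + k * (2 * b)) (sym (*-distribˡ-+ 2 β s))))) }
  step b rec T 3≤ u rng | inj₁ (β , refl) with all-or-some even-or-odd T
  ... | inj₂ (_ , a∈ , α , refl) = residues-mixed u rng a∈ λ s t → λ { (k , l , eq) →
    cong-parity {b} (β + s) (α + t) (k , l , ≡.trans (cong (_+ k * (2 * b)) (*-distribˡ-+ 2 β s))
      (≡.trans eq (cong (λ v → suc v + l * (2 * b)) (sym (*-distribˡ-+ 2 α t))))) }
  ... | inj₁ es with halve-all es
  ... | T′ , refl = subst (λ n → Residues b T (suc (2 * n))) (sym (length-map (2 *_) T′))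
    (transfer (λ x y → y ≡ 2 * x) (λ p → _ , punctured-scale 2 p , refl)
       (λ { refl refl ¬c → ¬c ∘ cong-halve 0 })
       (rec β<b T′ (subst (3 ≤_) (length-map (2 *_) T′) 3≤)
         (AllPairs.map (λ h → h ∘ cong (2 *_)) (AllPairsₚ.map⁻ u))
         (All.map (λ { {t} (0<2t , 2t<2β) → *-cancelˡ-< 2 0 t 0<2t , *-cancelˡ-< 2 t β 2t<2β }) (Allₚ.map⁻ rng))))
    where
    β<b : β < 2 * β
    β<b = double-< β (0<b 3≤ rng)
      where
      0<b : ∀ {L} → 3 ≤ length L → All (Range b) L → 0 < b
      0<b () []
      0<b _ ((_ , t<b) ∷ _) = ≤-<-trans z≤n t<b
      double-< : ∀ β → 0 < 2 * β → β < 2 * β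
      double-< (suc β) _ = m<m+n (suc β) z<s

-- Reflection of punctured sums, and sets of three elements.

AtLeast-weaken : ∀ {A : Set} {P : A → Set} {M N} → M ≤ N → AtLeast P N → AtLeast P M
AtLeast-weaken M≤N (l , u , p , N≤) = l , u , p , ≤-trans M≤N N≤

sub-complement : ∀ {L s} → SubsetSum L s → ∃ λ t → SubsetSum L t × s + t ≡ sum L
sub-complement [] = 0 , [] , refl
sub-complement (skip {a} {L} {s} p) = let t , q , eq = sub-complement p in
  a + t , take q , ≡.trans (swap-head s a t) (cong (a +_) eq)
  where
  swap-head : ∀ s a t → s + (a + t) ≡ a + (s + t)
  swap-head s a t = solve (s ◂ a ◂ t ◂ ∙)
sub-complement (take {a} {s = s} p) = let t , q , eq = sub-complement p in
  t , skip q , ≡.trans (+-assoc a s t) (cong (a +_) eq)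

sub-full : ∀ L → SubsetSum L (sum L)
sub-full [] = []
sub-full (a ∷ L) = take (sub-full L)

-- Replacing every cᵢ by 2 - cᵢ keeps the single coefficient 1. After the shift this is negation of
-- signed sums.
punctured-complement : ∀ {L s} → PuncturedSum L s → ∃ λ t → PuncturedSum L t × s + t ≡ 2 * sum L
punctured-complement (one {a} {L} {s} p) = let t , q , eq = sub-complement p in
  a + 2 * t , one q , ≡.trans (arith a s t) (cong (λ v → 2 * (a + v)) eq)
  where
  arith : ∀ a s t → a + 2 * s + (a + 2 * t) ≡ 2 * (a + (s + t))
  arith a s t = solve (a ◂ s ◂ t ◂ ∙)
punctured-complement (omit {a} {L} {s} p) = let t , q , eq = punctured-complement p in
  2 * a + t , two q , ≡.trans (arith a s t) (≡.trans (cong (2 * a +_) eq) (sym (*-distribˡ-+ 2 a (sum L))))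
  where
  arith : ∀ a s t → s + (2 * a + t) ≡ 2 * a + (s + t)
  arith a s t = solve (a ◂ s ◂ t ◂ ∙)
punctured-complement (two {a} {L} {s} p) = let t , q , eq = punctured-complement p in
  t , omit q , ≡.trans (+-assoc (2 * a) s t) (≡.trans (cong (2 * a +_) eq) (sym (*-distribˡ-+ 2 a (sum L))))

-- Reflection in `sum T` sends sums below it to sums above it, so listing the lower ones counts
-- twice.
lower-half : ∀ {T} l → Linked _<_ l → All (λ y → PuncturedSum T y × y < sum T) l →
  AtLeast (PuncturedSum T) (length l + length l)
lower-half {T} l inc ps
  with transfer {S = _≢_} {Q = λ t → PuncturedSum T t × sum T < t} (λ s t → s + t ≡ 2 * sum T)
         (λ { {s} (p , s<) → let t , q , eq = punctured-complement p in
              t , (q , cancel-< (sum T) t 0 s< (arith s t (sum T) eq)) , eq })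
         (λ { {x} {x′} {y} {y′} e e′ x≢ refl → x≢ (+-cancelʳ-≡ y x x′ (≡.trans e (sym e′))) })
         (l , unique , ps , ≤-refl)
  where
  unique : Unique l
  unique = AllPairs.map <⇒≢ (Linked⇒AllPairs <-trans inc)
  arith : ∀ s t σ → s + t ≡ 2 * σ → σ + σ + 0 ≡ t + s
  arith s t σ eq = begin
    σ + σ + 0 ≡⟨ solve (σ ◂ ∙) ⟩
    2 * σ     ≡⟨ eq ⟨
    s + t     ≡⟨ +-comm s t ⟩
    t + s     ∎
    where open ≡-Reasoning
... | l′ , u′ , ps′ , size = l ++ l′
  , AllPairsₚ.++⁺ (AllPairs.map <⇒≢ (Linked⇒AllPairs <-trans inc)) u′
      (All.map (λ s< → All.map (λ t> → <⇒≢ (<-trans (proj₂ s<) (proj₂ t>))) ps′) ps)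
  , Allₚ.++⁺ (All.map proj₁ ps) (All.map proj₁ ps′)
  , subst (_ ≤_) (sym (length-++ l)) (+-monoʳ-≤ (length l) size)

-- Unless r = 2p + q and 2p + r = 2q + p, five different sums lie below p + q + r. The two
-- equalities together give q = 3p and r = 5p.
triple : ∀ {p q r} → 0 < p → p < q → q < r →
  AtLeast (PuncturedSum (r ∷ q ∷ p ∷ [])) 10 ⊎ (q ≡ p * 3 × r ≡ p * 5)
triple {p} {q} {r} 0<p p<q q<r = split (<-cmp r (2 * p + q)) (<-cmp (2 * p + r) (2 * q + p))
  where
  L = r ∷ q ∷ p ∷ []
  Low : ℕ → Set
  Low y = PuncturedSum L y × y < r + (q + (p + 0))
  lp : Low p
  lp = omit (omit (punctured-∈ (here refl))) , cancel-< p (r + (q + (p + 0))) (q + p) (<-trans p<q q<r) (solve (p ◂ q ◂ r ◂ ∙))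
  lq : Low q
  lq = omit (punctured-∈ (here refl)) , cancel-< q (r + (q + (p + 0))) (q + p) q<r (solve (p ◂ q ◂ r ◂ ∙))
  lr : Low r
  lr = punctured-∈ (here refl) , cancel-< r (r + (q + (p + 0))) q 0<p (solve (p ◂ q ◂ r ◂ ∙))
  lpq : Low (2 * p + q)
  lpq = omit (punctured-cast (one (take [])) (solve (p ◂ q ◂ ∙))) , cancel-< (2 * p + q) (r + (q + (p + 0))) 0 (<-trans p<q q<r) (solve (p ◂ q ◂ r ◂ ∙))
  lpr : Low (2 * p + r)
  lpr = punctured-cast (one (skip (take []))) (solve (p ◂ r ◂ ∙)) , cancel-< (2 * p + r) (r + (q + (p + 0))) 0 p<q (solve (p ◂ q ◂ r ◂ ∙))
  lqp : Low (2 * q + p)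
  lqp = omit (two (punctured-∈ (here refl))) , cancel-< (2 * q + p) (r + (q + (p + 0))) 0 q<r (solve (p ◂ q ◂ r ◂ ∙))
  q<2p+q : q < 2 * p + q
  q<2p+q = cancel-< q (2 * p + q) p 0<p (solve (p ◂ q ◂ ∙))
  r<2p+r : r < 2 * p + r
  r<2p+r = cancel-< r (2 * p + r) p 0<p (solve (p ◂ r ◂ ∙))
  2p+q<2p+r : 2 * p + q < 2 * p + r
  2p+q<2p+r = +-monoʳ-< (2 * p) q<r
  2p+q<2q+p : 2 * p + q < 2 * q + p
  2p+q<2q+p = cancel-< (2 * p + q) (2 * q + p) 0 p<q (solve (p ◂ q ◂ ∙))
  split : _ → _ → AtLeast (PuncturedSum L) 10 ⊎ (q ≡ p * 3 × r ≡ p * 5)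
  split (tri< r<pq _ _) _ = inj₁ (lower-half (p ∷ q ∷ r ∷ 2 * p + q ∷ 2 * p + r ∷ [])
    (p<q ∷ q<r ∷ r<pq ∷ 2p+q<2p+r ∷ [-]) (lp ∷ lq ∷ lr ∷ lpq ∷ lpr ∷ []))
  split (tri> _ _ pq<r) _ = inj₁ (lower-half (p ∷ q ∷ 2 * p + q ∷ r ∷ 2 * p + r ∷ [])
    (p<q ∷ q<2p+q ∷ pq<r ∷ r<2p+r ∷ [-]) (lp ∷ lq ∷ lpq ∷ lr ∷ lpr ∷ []))
  split (tri≈ _ eq _) (tri< pr<qp _ _) = inj₁ (lower-half (p ∷ q ∷ r ∷ 2 * p + r ∷ 2 * q + p ∷ [])
    (p<q ∷ q<r ∷ r<2p+r ∷ pr<qp ∷ [-]) (lp ∷ lq ∷ lr ∷ lpr ∷ lqp ∷ []))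
  split (tri≈ _ eq _) (tri> _ _ qp<pr) = inj₁ (lower-half (p ∷ q ∷ r ∷ 2 * q + p ∷ 2 * p + r ∷ [])
    (p<q ∷ q<r ∷ subst (_< 2 * q + p) (sym eq) 2p+q<2q+p ∷ qp<pr ∷ [-]) (lp ∷ lq ∷ lr ∷ lqp ∷ lpr ∷ []))
  split (tri≈ _ eq _) (tri≈ _ eq′ _) = inj₂ (q≡3p , ≡.trans eq (≡.trans (cong (2 * p +_) q≡3p) (solve (p ◂ ∙))))
    where
    open ≡-Reasoning
    q≡3p : q ≡ p * 3
    q≡3p = +-cancelʳ-≡ (p + q) q (p * 3) (begin
      q + (p + q)           ≡⟨ solve (p ◂ q ◂ ∙) ⟩
      2 * q + p             ≡⟨ eq′ ⟨
      2 * p + r             ≡⟨ cong (2 * p +_) eq ⟩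
      2 * p + (2 * p + q)   ≡⟨ solve (p ◂ q ◂ ∙) ⟩
      p * 3 + (p + q)       ∎)

-- Odd progressions and the fourth element.

-- In descending order, so that adjoining a larger element is a cons.
odds : ℕ → ℕ → List ℕ
odds d = applyDownFrom (λ i → d * (2 * i + 1))

odds-positive : ∀ {d n} → All (0 <_) (odds d (suc n)) → 0 < d
odds-positive {d} (0<last ∷ _) = n≢0⇒n>0 λ { refl → <⇒≢ 0<last refl }

-- The last component, that every odd multiple of d below 2dn² is a sum, is what the next induction
-- step builds on.
Extremal : List ℕ → ℕ → Set
Extremal T n = ∃ λ d → T ≡ odds d n × (∀ i → i < n * n → PuncturedSum T (d * (2 * i + 1)))

Dichotomy : List ℕ → ℕ → Set
Dichotomy T n = AtLeast (PuncturedSum T) (suc (n * n)) ⊎ Extremal T n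

punctured-7531 : ∀ i → i < 16 → PuncturedSum (7 ∷ 5 ∷ 3 ∷ 1 ∷ []) (2 * i + 1)
punctured-7531 0 _ = omit (omit (omit (one [])))
punctured-7531 1 _ = omit (omit (one (skip [])))
punctured-7531 2 _ = omit (one (skip (skip [])))
punctured-7531 3 _ = one (skip (skip (skip [])))
punctured-7531 4 _ = one (skip (skip (take [])))
punctured-7531 5 _ = omit (two (omit (one [])))
punctured-7531 6 _ = one (skip (take (skip [])))
punctured-7531 7 _ = one (skip (take (take [])))
punctured-7531 8 _ = one (take (skip (skip [])))
punctured-7531 9 _ = one (take (skip (take [])))
punctured-7531 10 _ = two (omit (two (one [])))
punctured-7531 11 _ = one (take (take (skip [])))
punctured-7531 12 _ = one (take (take (take [])))
punctured-7531 13 _ = two (two (one (skip [])))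
punctured-7531 14 _ = two (two (one (take [])))
punctured-7531 15 _ = two (two (two (one [])))
punctured-7531 (suc (suc (suc (suc (suc (suc (suc (suc (suc (suc (suc (suc (suc (suc (suc (suc _)))))))))))))))) lt =
  contradiction lt (≤⇒≯ (m≤m+n 16 _))

-- The set p * {1, 3, 5} has only eight sums, 9p being missing, so `extend` would give 8 + 7 = 15
-- instead of 17. Hence explicit lists, and an induction starting at four elements.
module FourthElement (p b : ℕ) (0<p : 0 < p) (5p<b : p * 5 < b) where

  private
    instance _ = >-nonZero 0<p
    L = List.map (p *_) (5 ∷ 3 ∷ 1 ∷ [])

  Low : ℕ → Set
  Low y = PuncturedSum (b ∷ L) y × y < b + (p * 5 + (p * 3 + (p * 1 + 0)))

  mono : ∀ i j {_ : True (i <? j)} → p * i < p * j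
  mono i j {t} = *-monoʳ-< p (toWitness t)

  <-sum : ∀ {i} → i ≤ 13 → p * i < b + (p * 5 + (p * 3 + (p * 1 + 0)))
  <-sum {i} i≤ = ≤-<-trans (*-monoʳ-≤ p i≤) (cancel-< (p * 13) (b + (p * 5 + (p * 3 + (p * 1 + 0)))) p 5p<b (solve (p ◂ b ◂ ∙)))

  old : ∀ {s} → PuncturedSum (5 ∷ 3 ∷ 1 ∷ []) s → PuncturedSum (b ∷ L) (p * s)
  old q = omit (punctured-scale p q)

  low : ∀ {s} → PuncturedSum (5 ∷ 3 ∷ 1 ∷ []) s → {_ : True (s ≤? 13)} → Low (p * s)
  low q {t} = old q , <-sum (toWitness t)

  new : ∀ {s} → SubsetSum (5 ∷ 3 ∷ 1 ∷ []) s → {_ : True (s ≤? 4)} → Low (b + 2 * (p * s))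
  new {s} q {t} = one (sub-scale p q) ,
    ≤-<-trans (+-monoʳ-≤ b (*-monoʳ-≤ 2 (*-monoʳ-≤ p (toWitness t)))) (cancel-< (b + 2 * (p * 4)) (b + (p * 5 + (p * 3 + (p * 1 + 0)))) 0 0<p (solve (p ◂ b ◂ ∙)))

  l1 = low (omit (omit (one [])))
  l3 = low (omit (one (skip [])))
  l5 = low (one (skip (skip [])))
  l7 = low (one (skip (take [])))
  l11 = low (one (take (skip [])))
  l13 = low (one (take (take [])))
  n0 = new (skip (skip (skip [])))
  n1 = new (skip (skip (take [])))
  n3 = new (skip (take (skip [])))
  n4 = new (skip (take (take [])))

  module _ (8p<b : p * 8 < b) where

    l15 : Low (p * 15)
    l15 = old (two (one (take []))) , <-trans (mono 15 16) (cancel-< (p * 16) (b + (p * 5 + (p * 3 + (p * 1 + 0)))) p 8p<b (solve (p ◂ b ◂ ∙)))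

    l17 : Low (p * 17)
    l17 = old (two (two (one []))) , cancel-< (p * 17) (b + (p * 5 + (p * 3 + (p * 1 + 0)))) 0 8p<b (solve (p ◂ b ◂ ∙))

  -- For b ≠ 7p nine sums lie in the lower half, giving 18. How b compares with 7p and 9p decides
  -- which sums are listed and in what order; b = 9p fills the gap at 9p.
  dichotomy : Dichotomy (b ∷ L) 4
  dichotomy with <-cmp b (p * 7) | <-cmp b (p * 9)
  ... | tri≈ _ refl _ | _ = inj₂ (p , refl , λ i i<16 → punctured-scale p (punctured-7531 i i<16))
  ... | tri< b<7p _ _ | _ = inj₁ (AtLeast-weaken (n≤1+n 17) (lower-half
    (p * 1 ∷ p * 3 ∷ p * 5 ∷ b + 2 * (p * 0) ∷ p * 7 ∷ b + 2 * (p * 1) ∷ p * 11 ∷ b + 2 * (p * 3) ∷ p * 13 ∷ [])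
    ( mono 1 3 ∷ mono 3 5 ∷ cancel-< (p * 5) (b + 2 * (p * 0)) 0 5p<b (solve (p ◂ b ◂ ∙)) ∷ cancel-< (b + 2 * (p * 0)) (p * 7) 0 b<7p (solve (p ◂ b ◂ ∙))
    ∷ cancel-< (p * 7) (b + 2 * (p * 1)) 0 5p<b (solve (p ◂ b ◂ ∙)) ∷ cancel-< (b + 2 * (p * 1)) (p * 11) (p * 2) b<7p (solve (p ◂ b ◂ ∙))
    ∷ cancel-< (p * 11) (b + 2 * (p * 3)) 0 5p<b (solve (p ◂ b ◂ ∙)) ∷ cancel-< (b + 2 * (p * 3)) (p * 13) 0 b<7p (solve (p ◂ b ◂ ∙)) ∷ [-])
    (l1 ∷ l3 ∷ l5 ∷ n0 ∷ l7 ∷ n1 ∷ l11 ∷ n3 ∷ l13 ∷ [])))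
  ... | tri> _ _ 7p<b | tri< b<9p _ _ = inj₁ (AtLeast-weaken (n≤1+n 17) (lower-half
    (p * 1 ∷ p * 3 ∷ p * 5 ∷ p * 7 ∷ b + 2 * (p * 0) ∷ b + 2 * (p * 1) ∷ p * 11 ∷ p * 13 ∷ b + 2 * (p * 3) ∷ [])
    ( mono 1 3 ∷ mono 3 5 ∷ mono 5 7 ∷ cancel-< (p * 7) (b + 2 * (p * 0)) 0 7p<b (solve (p ◂ b ◂ ∙))
    ∷ cancel-< (b + 2 * (p * 0)) (b + 2 * (p * 1)) p 0<p (solve (p ◂ b ◂ ∙)) ∷ cancel-< (b + 2 * (p * 1)) (p * 11) 0 b<9p (solve (p ◂ b ◂ ∙)) ∷ mono 11 13
    ∷ cancel-< (p * 13) (b + 2 * (p * 3)) 0 7p<b (solve (p ◂ b ◂ ∙)) ∷ [-])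
    (l1 ∷ l3 ∷ l5 ∷ l7 ∷ n0 ∷ n1 ∷ l11 ∷ l13 ∷ n3 ∷ [])))
  ... | tri> _ _ 7p<b | tri≈ _ b≡9p _ = inj₁ (AtLeast-weaken (n≤1+n 17) (lower-half
    (p * 1 ∷ p * 3 ∷ p * 5 ∷ p * 7 ∷ b + 2 * (p * 0) ∷ p * 11 ∷ p * 13 ∷ p * 15 ∷ p * 17 ∷ [])
    ( mono 1 3 ∷ mono 3 5 ∷ mono 5 7 ∷ cancel-< (p * 7) (b + 2 * (p * 0)) 0 7p<b (solve (p ◂ b ◂ ∙))
    ∷ ≤-<-trans (≤-reflexive (≡.trans b+0 b≡9p)) (mono 9 11)
    ∷ mono 11 13 ∷ mono 13 15 ∷ mono 15 17 ∷ [-])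
    (l1 ∷ l3 ∷ l5 ∷ l7 ∷ n0 ∷ l11 ∷ l13 ∷ l15 8p<b ∷ l17 8p<b ∷ [])))
    where
    b+0 : b + 2 * (p * 0) ≡ b
    b+0 = solve (p ◂ b ◂ ∙)
    8p<b : p * 8 < b
    8p<b = subst (p * 8 <_) (sym b≡9p) (mono 8 9)
  ... | tri> _ _ 7p<b | tri> _ _ 9p<b = inj₁ (AtLeast-weaken (n≤1+n 17) (lower-half
    (p * 1 ∷ p * 3 ∷ p * 5 ∷ p * 7 ∷ p * 11 ∷ p * 13 ∷ p * 15 ∷ p * 17 ∷ b + 2 * (p * 4) ∷ [])
    ( mono 1 3 ∷ mono 3 5 ∷ mono 5 7 ∷ mono 7 11 ∷ mono 11 13 ∷ mono 13 15 ∷ mono 15 17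
    ∷ cancel-< (p * 17) (b + 2 * (p * 4)) 0 9p<b (solve (p ◂ b ◂ ∙)) ∷ [-])
    (l1 ∷ l3 ∷ l5 ∷ l7 ∷ l11 ∷ l13 ∷ l15 8p<b ∷ l17 8p<b ∷ n4 ∷ [])))
    where
    8p<b : p * 8 < b
    8p<b = <-trans (mono 8 9) 9p<b

-- Adjoining an element to an odd progression.

sum-odds : ∀ d n → sum (odds d n) ≡ d * (n * n)
sum-odds d zero = sym (*-zeroʳ d)
sum-odds d (suc n) = ≡.trans (cong (d * (2 * n + 1) +_) (sum-odds d n)) (solve (d ◂ n ◂ ∙))

-- Adjoining b to d * {1, 3, …, 2n - 1}, whose punctured sums are the odd
-- multiples of d below 2 * d * N for N = n².
module NextElement {d b N L} (0<d : 0 < d) (0<b : 0 < b) (0<N : 0 < N)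
                   (full : ∀ i → i < N → PuncturedSum L (d * (2 * i + 1))) where

  old : ℕ → ℕ
  old i = d * (2 * i + 1)

  new : ℕ → ℕ → ℕ
  new c j = 2 * b + d * (2 * (c + j) + 1)

  private
    instance _ = >-nonZero 0<d

  old-< : ∀ {i j} → i < j → old i < old j
  old-< i<j = *-monoʳ-< d (+-monoˡ-< 1 (*-monoʳ-< 2 i<j))

  new-< : ∀ c {i j} → i < j → new c i < new c j
  new-< c i<j = +-monoʳ-< (2 * b) (old-< (+-monoʳ-< c i<j))

  module _ (K c : ℕ) (N≡ : N ≡ c + K) (dK<b+d : d * K < b + d) where

    -- The least shifted sum minus the largest old one is 2b + d(2c + 1) - d(2N - 1) = 2(b + d -
    -- dK), positive by hypothesis.
    old<new : ∀ {i} j → i < N → old i < new c j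
    old<new {i} j i<N = begin-strict
      d * (2 * i + 1)              ≡⟨ solve (d ◂ i ◂ ∙) ⟩
      2 * (d * i) + d              <⟨ +-monoˡ-< d (*-monoʳ-< 2 di<) ⟩
      2 * (b + d * c) + d          ≤⟨ m≤m+n _ (2 * (d * j)) ⟩
      2 * (b + d * c) + d + 2 * (d * j) ≡⟨ solve (b ◂ d ◂ c ◂ j ◂ ∙) ⟩
      2 * b + d * (2 * (c + j) + 1) ∎
      where
      open ≤-Reasoning
      di< : d * i < b + d * c
      di< = +-cancelʳ-< d (d * i) (b + d * c) (begin-strict
        d * i + d        ≡⟨ solve (d ◂ i ◂ ∙) ⟩
        d * suc i        ≤⟨ *-monoʳ-≤ d i<N ⟩
        d * N            ≡⟨ cong (d *_) N≡ ⟩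
        d * (c + K)      ≡⟨ *-distribˡ-+ d c K ⟩
        d * c + d * K    <⟨ +-monoʳ-< (d * c) dK<b+d ⟩
        d * c + (b + d)  ≡⟨ solve (b ◂ c ◂ d ◂ ∙) ⟩
        b + d * c + d    ∎)

    join : List ℕ
    join = applyUpTo old N ++ applyUpTo (new c) K

    join-unique : Unique join
    join-unique = AllPairsₚ.++⁺
      (AllPairsₚ.applyUpTo⁺₁ old N (λ i<j _ → <⇒≢ (old-< i<j)))
      (AllPairsₚ.applyUpTo⁺₁ (new c) K (λ i<j _ → <⇒≢ (new-< c i<j)))
      (Allₚ.applyUpTo⁺₁ old N (λ i<N → Allₚ.applyUpTo⁺₁ (new c) K (λ {j} _ → <⇒≢ (old<new j i<N))))

    join-sums : All (PuncturedSum (b ∷ L)) join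
    join-sums = Allₚ.++⁺ (Allₚ.applyUpTo⁺₁ old N (λ i<N → omit (full _ i<N)))
      (Allₚ.applyUpTo⁺₁ (new c) K
        (λ {j} j<K → two (full (c + j) (subst (c + j <_) (sym N≡) (+-monoʳ-< c j<K)))))

    join-length : length join ≡ N + K
    join-length = ≡.trans (length-++ (applyUpTo old N))
      (cong₂ _+_ (length-applyUpTo old N) (length-applyUpTo (new c) K))

    join-many : AtLeast (PuncturedSum (b ∷ L)) (N + K)
    join-many = join , join-unique , join-sums , ≤-reflexive (sym join-length)

    -- The two extra sums are b and its reflection b + 2dN. If either were already listed, b would
    -- be an odd multiple of d.
    join-more : sum L ≡ d * N → (∀ i → b ≢ old i) → AtLeast (PuncturedSum (b ∷ L)) (2 + (N + K))
    join-more ΣL b≢ = b ∷ b + 2 * (d * N) ∷ join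
      , (<⇒≢ b<top ∷ Allₚ.++⁺ (Allₚ.applyUpTo⁺₂ old N b≢) (Allₚ.applyUpTo⁺₂ (new c) K (<⇒≢ ∘ b<new)))
        ∷ Allₚ.++⁺ (Allₚ.applyUpTo⁺₁ old N (λ i<N → >⇒≢ (old<top i<N)))
                   (Allₚ.applyUpTo⁺₁ (new c) K top≢new)
        ∷ join-unique
      , punctured-∈ (here refl) ∷ one (subst (SubsetSum L) ΣL (sub-full L)) ∷ join-sums
      , ≤-reflexive (cong (2 +_) (sym join-length))
      where
      open ≤-Reasoning
      b<new : ∀ j → b < new c j
      b<new j = <-≤-trans (m<m+n b (≤-trans 0<b (m≤m+n b 0))) (m≤m+n (2 * b) _)
      old<top : ∀ {i} → i < N → old i < b + 2 * (d * N)
      old<top {i} i<N = begin-strict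
        d * (2 * i + 1)   ≤⟨ *-monoʳ-≤ d (+-monoʳ-≤ (2 * i) (n≤1+n 1)) ⟩
        d * (2 * i + 2)   ≡⟨ solve (d ◂ i ◂ ∙) ⟩
        2 * (d * suc i)   ≤⟨ *-monoʳ-≤ 2 (*-monoʳ-≤ d i<N) ⟩
        2 * (d * N)       <⟨ m<n+m (2 * (d * N)) 0<b ⟩
        b + 2 * (d * N)   ∎
      top≢new : ∀ {j} → j < K → b + 2 * (d * N) ≢ new c j
      top≢new {j} j<K eq with m≤n⇒∃[o]m+o≡n j<K
      -- Here e = K - 1 - j, and the supposed equality solves to b = d(2e + 1).
      ... | e , refl = b≢ e (sym (+-cancelˡ-≡ (b + 2 * (d * c) + 2 * (d * j) + d) (old e) b
        (≡.trans (expand e) (≡.trans (sym (cong (λ n → b + 2 * (d * n)) N≡)) (≡.trans eq collect)))))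
        where
        expand : ∀ e → b + 2 * (d * c) + 2 * (d * j) + d + d * (2 * e + 1) ≡ b + 2 * (d * (c + (suc j + e)))
        expand e = solve (b ◂ c ◂ d ◂ j ◂ e ◂ ∙)
        collect : 2 * b + d * (2 * (c + j) + 1) ≡ b + 2 * (d * c) + 2 * (d * j) + d + b
        collect = solve (b ◂ c ◂ d ◂ j ◂ ∙)
      b<top : b < b + 2 * (d * N)
      b<top = m<m+n b (*-mono-< {0} {2} {0} z<s (*-mono-< {0} {d} {0} {N} 0<d 0<N))

-- Coefficient 2 on the new element raises the index by 2n + 1. As 2n + 1 ≤ n², the old and the
-- raised indices together cover everything below (n + 1)².
next-odds : ∀ {d n L} → 2 * n + 1 ≤ n * n → (∀ i → i < n * n → PuncturedSum L (d * (2 * i + 1))) →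
  ∀ i → i < suc n * suc n → PuncturedSum (d * (2 * n + 1) ∷ L) (d * (2 * i + 1))
next-odds {d} {n} {L} n≤ full i i< with i <? n * n
... | yes i<n² = omit (full i i<n²)
... | no i≮n² = let j , eq = m≤n⇒∃[o]m+o≡n (≤-trans n≤ (≮⇒≥ i≮n²)) in shifted j eq
  where
  square : suc n * suc n ≡ 2 * n + 1 + n * n
  square = solve (n ◂ ∙)
  arith : ∀ j → 2 * (d * (2 * n + 1)) + d * (2 * j + 1) ≡ d * (2 * (2 * n + 1 + j) + 1)
  arith j = solve (d ◂ n ◂ j ◂ ∙)
  shifted : ∀ j → 2 * n + 1 + j ≡ i → PuncturedSum (d * (2 * n + 1) ∷ L) (d * (2 * i + 1))
  shifted j eq = punctured-cast
    (two (full j (+-cancelˡ-< (2 * n + 1) j (n * n) (subst₂ _<_ (sym eq) square i<))))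
    (≡.trans (arith j) (cong (λ m → d * (2 * m + 1)) eq))

-- Strictly between consecutive odd multiples of d, b is not one itself, so two extra sums join the
-- 2(n + 1) shifted ones.
next-below : ∀ {d b n c} → let N = suc n * suc n in N ≡ c + 2 * suc n → 0 < d →
  (∀ i → i < N → PuncturedSum (odds d (suc n)) (d * (2 * i + 1))) →
  d * (2 * n + 1) < b → b < d * (2 * suc n + 1) →
  AtLeast (PuncturedSum (b ∷ odds d (suc n))) (2 + (N + 2 * suc n))
next-below {d} {b} {n} {c} N≡ 0<d full last<b b<next =
  join-more (2 * suc n) c N≡
    (cancel-< (d * (2 * suc n)) (b + d) 0 last<b (solve (d ◂ n ◂ b ◂ ∙))) (sum-odds d (suc n)) not-odd
  where
  instance _ = >-nonZero 0<d
  open NextElement 0<d (≤-<-trans z≤n last<b) z<s full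
  not-odd : ∀ i → b ≢ d * (2 * i + 1)
  not-odd i refl = <⇒≱ (cancel n i last<b) (≤-pred (cancel i (suc n) b<next))
    where
    cancel : ∀ i j → d * (2 * i + 1) < d * (2 * j + 1) → i < j
    cancel i j p = *-cancelˡ-< 2 i j (+-cancelʳ-< 1 (2 * i) (2 * j) (*-cancelˡ-< d _ _ p))

-- A larger b lets two more old sums clear the old range when shifted by 2b.
next-above : ∀ {d b n c} → let N = suc n * suc n in N ≡ c + (2 * suc n + 2) → 0 < d →
  (∀ i → i < N → PuncturedSum (odds d (suc n)) (d * (2 * i + 1))) →
  d * (2 * suc n + 1) < b →
  AtLeast (PuncturedSum (b ∷ odds d (suc n))) (N + (2 * suc n + 2))
next-above {d} {b} {n} {c} N≡ 0<d full next<b =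
  join-many (2 * suc n + 2) c N≡
    (cancel-< (d * (2 * suc n + 2)) (b + d) 0 next<b (solve (d ◂ n ◂ b ◂ ∙)))
  where open NextElement 0<d (≤-<-trans z≤n next<b) z<s full

-- Induction on the number of elements in the case n = h + 1.

-- The equation for c guarantees that there are at least 2(n + 1) + 2 old sums to shift.
dichotomy-step : ∀ {n c b L} → let N = suc n * suc n in N ≡ c + (2 * suc n + 2) → 3 ≤ suc n →
  AllPairs _>_ (b ∷ L) → All (0 <_) (b ∷ L) → length L ≡ suc n →
  Dichotomy L (suc n) → Dichotomy (b ∷ L) (2 + n)
dichotomy-step {n} {_} {b} {L} _ 3≤ (b> ∷ desc) (0<b ∷ 0<L) len (inj₁ many) =
  inj₁ (AtLeast-weaken (≤-reflexive (≡.trans (square n) (cong (λ m → suc (suc n * suc n) + suc (2 * m)) (sym len))))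
    (extend 0<b many (residues b L (subst (3 ≤_) (sym len) 3≤) (AllPairs.map >⇒≢ desc) (All.zip (0<L , b>)))))
  where
  square : ∀ n → suc ((2 + n) * (2 + n)) ≡ suc (suc n * suc n) + suc (2 * suc n)
  square n = solve (n ◂ ∙)
dichotomy-step {n} {c} {b} N≡ _ ((last<b ∷ _) ∷ _) (_ ∷ 0<L) _ (inj₂ (d , refl , full))
  with <-cmp b (d * (2 * suc n + 1))
... | tri≈ _ refl _ = inj₂ (d , refl , next-odds {d} {suc n} (subst (2 * suc n + 1 ≤_) (sym N≡)
        (≤-trans (+-monoʳ-≤ (2 * suc n) (n≤1+n 1)) (m≤n+m (2 * suc n + 2) c))) full)
... | tri< b<next _ _ = inj₁ (AtLeast-weaken (≤-reflexive (square n))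
        (next-below (≡.trans N≡ (arith c n)) 0<d full last<b b<next))
  where
  0<d : 0 < d
  0<d = odds-positive {d} {n} 0<L
  arith : ∀ c n → c + (2 * suc n + 2) ≡ c + 2 + 2 * suc n
  arith c n = solve (c ◂ n ◂ ∙)
  square : ∀ n → suc ((2 + n) * (2 + n)) ≡ 2 + (suc n * suc n + 2 * suc n)
  square n = solve (n ◂ ∙)
... | tri> _ _ next<b = inj₁ (AtLeast-weaken (≤-reflexive (square n)) (next-above {c = c} N≡ 0<d full next<b))
  where
  0<d : 0 < d
  0<d = odds-positive {d} {n} 0<L
  square : ∀ n → suc ((2 + n) * (2 + n)) ≡ suc n * suc n + (2 * suc n + 2)
  square n = solve (n ◂ ∙)

dichotomy : ∀ k {L} → AllPairs _>_ L → All (0 <_) L → length L ≡ 4 + k → Dichotomy L (4 + k)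
dichotomy zero {b ∷ r ∷ q ∷ p ∷ []} desc@(b>@(b>r ∷ _) ∷ (r>q ∷ _) ∷ (q>p ∷ _) ∷ _) (0<b ∷ 0<L@(_ ∷ _ ∷ 0<p ∷ _)) _
  with triple 0<p q>p r>q
-- Ten sums and seven classes: 10 + 7 = 4² + 1.
... | inj₁ many = inj₁ (extend 0<b many (residues b (r ∷ q ∷ p ∷ []) ≤-refl
        (AllPairs.map >⇒≢ (AllPairs.tail desc)) (All.zip (0<L , b>))))
... | inj₂ (refl , refl) = subst (λ x → Dichotomy (b ∷ p * 5 ∷ p * 3 ∷ x ∷ []) 4) (*-identityʳ p)
        (FourthElement.dichotomy p b 0<p b>r)
dichotomy (suc k) {b ∷ L} desc@(_ ∷ desc′) 0<L@(_ ∷ 0<L′) len =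
  dichotomy-step {c = k * k + 6 * k + 6} (square k) (s≤s (s≤s (s≤s z≤n))) desc 0<L (suc-injective len) (dichotomy k desc′ 0<L′ (suc-injective len))
  where
  square : ∀ k → (4 + k) * (4 + k) ≡ k * k + 6 * k + 6 + (2 * (4 + k) + 2)
  square k = solve (k ◂ ∙)

-- Signed sums

open import Data.Integer as ℤ using (ℤ; +_; 0ℤ; ∣_∣)
import Data.Integer.Divisibility.Signed as ℤ∣
import Data.Integer.Properties as ℤₚ
import Data.Integer.Tactic.RingSolver as ℤSolver

data SignedSum : List ℕ → ℕ → ℤ → Set where
  []   : SignedSum [] 0 0ℤ
  sgn  : ∀ s {a L h z} → SignedSum L h z → SignedSum (a ∷ L) (absSign s + h) (applySign s (+ a) ℤ.+ z)

signed-↭ : ∀ {L L′ h z} → L ↭ L′ → SignedSum L h z → SignedSum L′ h z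
signed-↭ refl p = p
signed-↭ (prep x π) (sgn s p) = sgn s (signed-↭ π p)
signed-↭ (swap x y π) (sgn s (sgn t {h = h} {z = z} p)) =
  subst₂ (SignedSum _) (comm-ℕ (absSign t) (absSign s) h) (comm-ℤ (applySign t (+ y)) (applySign s (+ x)) z)
    (sgn t (sgn s (signed-↭ π p)))
  where
  comm-ℕ : ∀ a b c → a + (b + c) ≡ b + (a + c)
  comm-ℕ a b c = solve (a ◂ b ◂ c ◂ ∙)
  comm-ℤ : ∀ a b c → a ℤ.+ (b ℤ.+ c) ≡ b ℤ.+ (a ℤ.+ c)
  comm-ℤ a b c = ℤSolver.solve (a ◂ b ◂ c ◂ ∙)
signed-↭ (trans π π′) p = signed-↭ π′ (signed-↭ π p)

signed-neg : ∀ {L h z} → SignedSum L h z → SignedSum L h (ℤ.- z)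
signed-neg [] = []
signed-neg (sgn neg {a} {z = z} p) = subst (SignedSum _ _) (flip (+ a) z) (sgn pos (signed-neg p))
  where
  flip : ∀ a z → a ℤ.+ ℤ.- z ≡ ℤ.- (ℤ.- a ℤ.+ z)
  flip a z = ℤSolver.solve (a ◂ z ◂ ∙)
signed-neg (sgn zer {z = z} p) = subst (SignedSum _ _) (flip z) (sgn zer (signed-neg p))
  where
  flip : ∀ z → 0ℤ ℤ.+ ℤ.- z ≡ ℤ.- (0ℤ ℤ.+ z)
  flip z = ≡.trans (ℤₚ.+-identityˡ _) (cong ℤ.-_ (sym (ℤₚ.+-identityˡ z)))
signed-neg (sgn pos {a} {z = z} p) = subst (SignedSum _ _) (sym (ℤₚ.neg-distrib-+ (+ a) z)) (sgn neg (signed-neg p))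

drop-neg : ∀ a z σ → (ℤ.- a ℤ.+ z) ℤ.+ (a ℤ.+ σ) ≡ z ℤ.+ σ
drop-neg a z σ = ℤSolver.solve (a ◂ z ◂ σ ◂ ∙)

double-pos : ∀ a z σ → (a ℤ.+ z) ℤ.+ (a ℤ.+ σ) ≡ (a ℤ.+ a) ℤ.+ (z ℤ.+ σ)
double-pos a z σ = ℤSolver.solve (a ◂ z ◂ σ ◂ ∙)

signed-subset : ∀ {L s} → SubsetSum L s → ∃ λ z → SignedSum L (length L) z × z ℤ.+ + sum L ≡ + (2 * s)
signed-subset [] = 0ℤ , [] , refl
signed-subset (skip {a} {L} p) = let z , q , eq = signed-subset p in
  _ , sgn neg q , ≡.trans (drop-neg (+ a) z (+ sum L)) eq
signed-subset (take {a} {L} {s} p) = let z , q , eq = signed-subset p in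
  _ , sgn pos q , ≡.trans (double-pos (+ a) z (+ sum L))
    (≡.trans (cong (λ v → (+ a ℤ.+ + a) ℤ.+ v) eq) (cong +_ (arith a s)))
  where
  arith : ∀ a s → a + a + 2 * s ≡ 2 * (a + s)
  arith a s = solve (a ◂ s ◂ ∙)

-- Some element carries the coefficient 1, so `pred` never meets an empty list.
punctured-length : ∀ {L y} → PuncturedSum L y → suc (pred (length L)) ≡ length L
punctured-length (one _) = refl
punctured-length (omit _) = refl
punctured-length (two _) = refl

-- The signs are λᵢ = cᵢ - 1; the single coefficient 1 becomes the single zero sign.
signed-punctured : ∀ {L y} → PuncturedSum L y → ∃ λ z → SignedSum L (pred (length L)) z × z ℤ.+ + sum L ≡ + y
signed-punctured (one {a} {L} {s} p) = let z , q , eq = signed-subset p in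
  _ , sgn zer q , ≡.trans (skip-zero (+ a) z (+ sum L)) (cong (λ v → + a ℤ.+ v) eq)
  where
  skip-zero : ∀ a z σ → (0ℤ ℤ.+ z) ℤ.+ (a ℤ.+ σ) ≡ a ℤ.+ (z ℤ.+ σ)
  skip-zero a z σ = ℤSolver.solve (a ◂ z ◂ σ ◂ ∙)
signed-punctured (omit {a} {L} p) = let z , q , eq = signed-punctured p in
  _ , subst (λ h → SignedSum (a ∷ L) h (ℤ.- + a ℤ.+ z)) (punctured-length p) (sgn neg q) , ≡.trans (drop-neg (+ a) z (+ sum L)) eq
signed-punctured (two {a} {L} {s} p) = let z , q , eq = signed-punctured p in
  _ , subst (λ h → SignedSum (a ∷ L) h (+ a ℤ.+ z)) (punctured-length p) (sgn pos q) , ≡.trans (double-pos (+ a) z (+ sum L))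
    (≡.trans (cong (λ v → (+ a ℤ.+ + a) ℤ.+ v) eq) (cong (λ v → + (a + v + s)) (sym (+-identityʳ a))))

signed-many : ∀ {L h N} → length L ≡ suc h → AtLeast (PuncturedSum L) N → AtLeast (SignedSum L h) N
signed-many {L} {h} len = transfer (λ y z → z ℤ.+ + sum L ≡ + y)
  (λ p → let z , q , eq = signed-punctured p in z , subst (λ n → SignedSum L (pred n) z) len q , eq)
  (λ e e′ y≢ eq → y≢ (ℤₚ.+-injective (≡.trans (sym e) (≡.trans (cong (ℤ._+ + sum L) eq) e′))))

-- The largest signed sum and exchanges with a new element.

-- For a descending list of length at least h, the largest h-fold signed sum.
top : ℕ → List ℕ → ℕ
top h L = sum (List.take h L)

signed-top : ∀ h {L} → h ≤ length L → SignedSum L h (+ top h L)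
signed-top zero {[]} _ = []
signed-top zero {a ∷ L} _ = sgn zer (signed-top zero {L} z≤n)
signed-top (suc h) {a ∷ L} (s≤s h≤) = sgn pos (signed-top h h≤)

signed-top-without : ∀ h {L t} → suc h ≤ length L → t ∈ List.take (suc h) L →
  ∃ λ s → SignedSum L h (+ s) × s + t ≡ top (suc h) L
signed-top-without h {a ∷ L} (s≤s h≤) (here refl) = top h L , sgn zer (signed-top h h≤) , +-comm (top h L) a
signed-top-without (suc h) {a ∷ L} {t} (s≤s h≤) (there t∈) = let s , p , eq = signed-top-without h h≤ t∈ in
  a + s , sgn pos p , ≡.trans (+-assoc a s t) (cong (λ v → a + v) eq)

top-mono : ∀ h {a L} → AllPairs _>_ (a ∷ L) → top h L ≤ top h (a ∷ L)
top-mono zero _ = z≤n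
top-mono (suc h) {a} {[]} _ = z≤n
top-mono (suc h) {a} {c ∷ L} ((c<a ∷ _) ∷ desc) = +-mono-≤ (<⇒≤ c<a) (top-mono h desc)

signed-bound : ∀ {L h z} → AllPairs _>_ L → SignedSum L h z → ∣ z ∣ ≤ top h L
signed-bound [] [] = z≤n
signed-bound desc@(_ ∷ desc′) (sgn neg {a} {h = h} {z = z} p) = ≤-trans (ℤₚ.∣i+j∣≤∣i∣+∣j∣ (ℤ.- + a) z)
  (+-mono-≤ (≤-reflexive (ℤₚ.∣-i∣≡∣i∣ (+ a))) (signed-bound desc′ p))
signed-bound desc@(_ ∷ desc′) (sgn zer {h = h} {z = z} p) =
  ≤-trans (≤-reflexive (cong ∣_∣ (ℤₚ.+-identityˡ z))) (≤-trans (signed-bound desc′ p) (top-mono h desc))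
signed-bound desc@(_ ∷ desc′) (sgn pos {a} {h = h} {z = z} p) = ≤-trans (ℤₚ.∣i+j∣≤∣i∣+∣j∣ (+ a) z)
  (+-monoʳ-≤ a (signed-bound desc′ p))

-- Restricted to positive values, since each v stands for the pair v and -v.
New : ℕ → List ℕ → ℕ → ℕ → Set
New b L h v = 0 < v × SignedSum (b ∷ L) h (+ v) × ¬ SignedSum L h (+ v)

-- The old sums are closed under negation, so -v is new whenever v is.
signed-extend : ∀ {b L h M N} → AtLeast (SignedSum L h) M → AtLeast (New b L h) N →
  AtLeast (SignedSum (b ∷ L) h) (M + (N + N))
signed-extend {b} {L} {h} (l , u , ps , M≤) (vs , uv , new , N≤) =
    l ++ (List.map +_ vs ++ List.map (λ v → ℤ.- + v) vs)
  , AllPairsₚ.++⁺ u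
      (AllPairsₚ.++⁺ (AllPairsₚ.map⁺ (AllPairs.map (λ v≢ → v≢ ∘ ℤₚ.+-injective) uv))
                     (AllPairsₚ.map⁺ (AllPairs.map (λ v≢ → v≢ ∘ ℤₚ.+-injective ∘ ℤₚ.neg-injective) uv))
                     (Allₚ.map⁺ (All.map (λ {v} n → Allₚ.map⁺ (All.map (λ {w} → pos≢neg v w (proj₁ n)) new)) new)))
      (All.map (λ p → Allₚ.++⁺ (Allₚ.map⁺ (All.map (λ { (_ , _ , ¬old) refl → ¬old p }) new))
                               (Allₚ.map⁺ (All.map (λ { {v} (_ , _ , ¬old) refl →
                                  ¬old (subst (SignedSum L h) (ℤₚ.neg-involutive (+ v)) (signed-neg p)) }) new))) ps)
  , Allₚ.++⁺ (All.map (λ {z} p → subst (SignedSum _ _) (ℤₚ.+-identityˡ z) (sgn zer p)) ps)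
      (Allₚ.++⁺ (Allₚ.map⁺ (All.map (proj₁ ∘ proj₂) new)) (Allₚ.map⁺ (All.map (signed-neg ∘ proj₁ ∘ proj₂) new)))
  , subst (_ ≤_) (sym size) (+-mono-≤ M≤ (+-mono-≤ N≤ N≤))
  where
  pos≢neg : ∀ v w → 0 < v → New b L h w → + v ≢ ℤ.- + w
  pos≢neg (suc v) (suc w) _ _ ()
  pos≢neg _ zero _ (() , _)
  size : length (l ++ (List.map +_ vs ++ List.map (λ v → ℤ.- + v) vs)) ≡ length l + (length vs + length vs)
  size = ≡.trans (length-++ l) (cong (λ v → length l + v) (≡.trans (length-++ (List.map +_ vs))
    (cong₂ _+_ (length-map +_ vs) (length-map (λ v → ℤ.- + v) vs))))

-- Remembers the element t that b replaces, so that a further value can be told apart from all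
-- exchanges.
Exchange : ℕ → List ℕ → ℕ → ℕ → Set
Exchange b L h v = New b L h v × ∃ λ t → t ∈ List.take h L × v + t ≡ b + top h L

-- Replacing t < b by b in the largest sum exceeds the bound for old sums, and different t give
-- different values.
exchanges : ∀ {b L} h → AllPairs _>_ (b ∷ L) → suc h ≤ length L → AtLeast (Exchange b L (suc h)) (suc h)
exchanges {b} {L} h (b> ∷ desc) h< = transfer {P = _∈ List.take (suc h) L} (λ t v → v + t ≡ b + top (suc h) L)
  (λ {t} t∈ → let s , p , eq = signed-top-without h h< t∈
                  v+t = ≡.trans (+-assoc b s t) (cong (λ v → b + v) eq)
              in b + s , ((≤-trans (≤-<-trans z≤n (t<b t∈)) (m≤m+n b s) , sgn pos p
                   , λ q → <⇒≱ (beyond s eq (t<b t∈)) (signed-bound desc q)) , t , t∈ , v+t) , v+t)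
  (λ { {x} {x′} {v} e e′ x≢ refl → x≢ (+-cancelˡ-≡ v x x′ (≡.trans e (sym e′))) })
  (List.take (suc h) L , AllPairsₚ.take⁺ (suc h) (AllPairs.map >⇒≢ desc) , All.tabulate (λ t∈ → t∈)
    , ≤-reflexive (sym (≡.trans (length-take (suc h) L) (m≤n⇒m⊓n≡m h<))))
  where
  t<b : ∀ {t} → t ∈ List.take (suc h) L → t < b
  t<b t∈ = All.lookup (Allₚ.take⁺ (suc h) b>) t∈
  beyond : ∀ s {t} → s + t ≡ top (suc h) L → t < b → top (suc h) L < b + s
  beyond s {t} eq t<b = subst (_< b + s) eq (subst (s + t <_) (+-comm s b) (+-monoʳ-< s t<b))

-- Signed sums over an odd progression.

-- Whatever the signs, h odd multiples of d add up to hd modulo 2d.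
signed-odds : ∀ d n {h z} → SignedSum (odds d n) h z → ∃ λ w → z ℤ.+ + h ℤ.* + d ≡ w ℤ.* (+ 2 ℤ.* + d)
signed-odds d zero [] = 0ℤ , refl
signed-odds d (suc n) (sgn s {h = h} {z = z} p) = let w , eq = signed-odds d n p in next s w eq
  where
  cast : + (d * (2 * n + 1)) ≡ + d ℤ.* (+ 2 ℤ.* + n ℤ.+ + 1)
  cast = ≡.trans (ℤₚ.pos-* d (2 * n + 1)) (cong (λ v → + d ℤ.* (v ℤ.+ + 1)) (ℤₚ.pos-* 2 n))
  identity-neg : ∀ D N H Z W → Z ℤ.+ H ℤ.* D ≡ W ℤ.* (+ 2 ℤ.* D) →
    (ℤ.- (D ℤ.* (+ 2 ℤ.* N ℤ.+ + 1)) ℤ.+ Z) ℤ.+ (+ 1 ℤ.+ H) ℤ.* D ≡ (W ℤ.+ ℤ.- N) ℤ.* (+ 2 ℤ.* D)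
  identity-neg D N H Z W eq = begin
    (ℤ.- (D ℤ.* (+ 2 ℤ.* N ℤ.+ + 1)) ℤ.+ Z) ℤ.+ (+ 1 ℤ.+ H) ℤ.* D
      ≡⟨ ℤSolver.solve (D ◂ N ◂ H ◂ Z ◂ ∙) ⟩
    (Z ℤ.+ H ℤ.* D) ℤ.+ ℤ.- N ℤ.* (+ 2 ℤ.* D)
      ≡⟨ cong (ℤ._+ ℤ.- N ℤ.* (+ 2 ℤ.* D)) eq ⟩
    W ℤ.* (+ 2 ℤ.* D) ℤ.+ ℤ.- N ℤ.* (+ 2 ℤ.* D)
      ≡⟨ ℤₚ.*-distribʳ-+ (+ 2 ℤ.* D) W (ℤ.- N) ⟨
    (W ℤ.+ ℤ.- N) ℤ.* (+ 2 ℤ.* D) ∎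
    where open ≡-Reasoning
  identity-pos : ∀ D N H Z W → Z ℤ.+ H ℤ.* D ≡ W ℤ.* (+ 2 ℤ.* D) →
    (D ℤ.* (+ 2 ℤ.* N ℤ.+ + 1) ℤ.+ Z) ℤ.+ (+ 1 ℤ.+ H) ℤ.* D ≡ (W ℤ.+ (N ℤ.+ + 1)) ℤ.* (+ 2 ℤ.* D)
  identity-pos D N H Z W eq = begin
    (D ℤ.* (+ 2 ℤ.* N ℤ.+ + 1) ℤ.+ Z) ℤ.+ (+ 1 ℤ.+ H) ℤ.* D
      ≡⟨ ℤSolver.solve (D ◂ N ◂ H ◂ Z ◂ ∙) ⟩
    (Z ℤ.+ H ℤ.* D) ℤ.+ (N ℤ.+ + 1) ℤ.* (+ 2 ℤ.* D)
      ≡⟨ cong (ℤ._+ (N ℤ.+ + 1) ℤ.* (+ 2 ℤ.* D)) eq ⟩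
    W ℤ.* (+ 2 ℤ.* D) ℤ.+ (N ℤ.+ + 1) ℤ.* (+ 2 ℤ.* D)
      ≡⟨ ℤₚ.*-distribʳ-+ (+ 2 ℤ.* D) W (N ℤ.+ + 1) ⟨
    (W ℤ.+ (N ℤ.+ + 1)) ℤ.* (+ 2 ℤ.* D) ∎
    where open ≡-Reasoning
  next : ∀ s w → z ℤ.+ + h ℤ.* + d ≡ w ℤ.* (+ 2 ℤ.* + d) →
    ∃ λ w′ → (applySign s (+ (d * (2 * n + 1))) ℤ.+ z) ℤ.+ + (absSign s + h) ℤ.* + d ≡ w′ ℤ.* (+ 2 ℤ.* + d)
  next neg w eq = w ℤ.+ ℤ.- + n , ≡.trans (cong (λ v → (ℤ.- v ℤ.+ z) ℤ.+ + suc h ℤ.* + d) cast) (identity-neg (+ d) (+ n) (+ h) z w eq)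
  next zer w eq = w , ≡.trans (cong (ℤ._+ + h ℤ.* + d) (ℤₚ.+-identityˡ z)) eq
  next pos w eq = w ℤ.+ (+ n ℤ.+ + 1) , ≡.trans (cong (λ v → (v ℤ.+ z) ℤ.+ + suc h ℤ.* + d) cast) (identity-pos (+ d) (+ n) (+ h) z w eq)

signed-odds-gap : ∀ {d n h x y} → SignedSum (odds d n) h (+ x) → SignedSum (odds d n) h (+ (x + y)) →
  0 < y → 2 * d ≤ y
signed-odds-gap {d} {n} {h} {x} {y} p q 0<y =
  let w , eq = signed-odds d n p ; w′ , eq′ = signed-odds d n q
  in ∣⇒≤ ⦃ >-nonZero 0<y ⦄ (ℤ∣.∣⇒∣ᵤ {+ (2 * d)} {+ y} (ℤ∣.divides (w′ ℤ.+ ℤ.- w)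
       (≡.trans (difference (+ x) (+ y) (+ h ℤ.* + d) w w′ (+ 2 ℤ.* + d) eq eq′)
         (cong (λ v → (w′ ℤ.+ ℤ.- w) ℤ.* v) (sym (ℤₚ.pos-* 2 d))))))
  where
  difference : ∀ X Y H W W′ D → X ℤ.+ H ≡ W ℤ.* D → (X ℤ.+ Y) ℤ.+ H ≡ W′ ℤ.* D → Y ≡ (W′ ℤ.+ ℤ.- W) ℤ.* D
  difference X Y H W W′ D eq eq′ = begin
    Y                                        ≡⟨ ℤSolver.solve (X ◂ Y ◂ H ◂ ∙) ⟩
    ((X ℤ.+ Y) ℤ.+ H) ℤ.+ ℤ.- (X ℤ.+ H)      ≡⟨ cong₂ (λ u v → u ℤ.+ ℤ.- v) eq′ eq ⟩
    W′ ℤ.* D ℤ.+ ℤ.- (W ℤ.* D)               ≡⟨ ℤSolver.solve (W ◂ W′ ◂ D ◂ ∙) ⟩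
    (W′ ℤ.+ ℤ.- W) ℤ.* D                     ∎
    where open ≡-Reasoning

-- The smallest of the j + 1 largest elements is exchanged for the next one, which is 2d smaller;
-- hence 2 + j ≤ n.
signed-top-lowered : ∀ d j n → 2 + j ≤ n → ∃ λ s → SignedSum (odds d n) (suc j) (+ s) × s + 2 * d ≡ top (suc j) (odds d n)
signed-top-lowered d zero (suc (suc n)) (s≤s (s≤s _)) =
  d * (2 * n + 1) + 0 , sgn zer (sgn pos (signed-top 0 {odds d n} z≤n)) , arith
  where
  arith : d * (2 * n + 1) + 0 + 2 * d ≡ d * (2 * suc n + 1) + 0
  arith = solve (d ◂ n ◂ ∙)
signed-top-lowered d (suc j) (suc n) (s≤s j≤) = let s , p , eq = signed-top-lowered d j n j≤ in
  d * (2 * n + 1) + s , sgn pos p , ≡.trans (+-assoc (d * (2 * n + 1)) s (2 * d)) (cong (λ v → d * (2 * n + 1) + v) eq)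

odds-descending : ∀ d n → 0 < d → AllPairs _>_ (odds d n)
odds-descending d n 0<d = AllPairsₚ.applyDownFrom⁺₁ _ n
  (λ j<i _ → *-monoʳ-< d ⦃ >-nonZero 0<d ⦄ (+-monoˡ-< 1 (*-monoʳ-< 2 j<i)))

odds-< : ∀ {d n t} → 0 < d → t ∈ odds d n → t < d * (2 * n + 1)
odds-< {d} {n} 0<d t∈ = All.lookup (AllPairs.head (odds-descending d (suc n) 0<d)) t∈

-- The extra value b + s equals b + M - t for the fictitious t = d(2n + 3), which exceeds every
-- element of L, so it differs from all exchanges.
exchanges-odds : ∀ {d n b} j → 0 < d → 2 + j ≤ n → d * (2 * n + 1) < b → b ≢ d * (2 * suc n + 1) →
  AtLeast (New b (odds d (suc n)) (2 + j)) (3 + j)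
exchanges-odds {d} {n} {b} j 0<d j≤ last<b b≢next =
  let s , p , eq = signed-top-lowered d j n j≤
      e+next = total s eq
      vs , u , ex , size = exchanges (suc j) (b> ∷ desc) len
  in b + s ∷ vs
   , All.map (λ { (_ , t , t∈ , v+t) refl → <⇒≢ (odds-< 0<d (take⊆ t∈))
         (+-cancelˡ-≡ (b + s) _ _ (≡.trans v+t (sym e+next))) }) ex ∷ u
   , (≤-trans 0<b (m≤m+n b s) , sgn pos (sgn zer p) , fresh s e+next) ∷ All.map proj₁ ex
   , s≤s size
  where
  L = odds d (suc n)
  M = top (2 + j) L
  desc = odds-descending d (suc n) 0<d
  b> : All (_< b) L
  b> = last<b ∷ All.map (λ t< → <-trans t< last<b) (AllPairs.head desc)
  0<b : 0 < b
  0<b = ≤-<-trans z≤n last<b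
  len : 2 + j ≤ length L
  len = subst (2 + j ≤_) (sym (length-applyDownFrom (λ i → d * (2 * i + 1)) (suc n))) (≤-trans j≤ (n≤1+n n))
  take⊆ : ∀ {t} → t ∈ List.take (2 + j) L → t ∈ L
  take⊆ {t} t∈ = subst (t ∈_) (take++drop≡id (2 + j) L) (∈-++⁺ˡ t∈)
  total : ∀ s → s + 2 * d ≡ top (suc j) (odds d n) → b + s + d * (2 * suc n + 1) ≡ b + M
  total s eq = ≡.trans (arith s) (cong (λ v → b + (d * (2 * n + 1) + v)) eq)
    where
    arith : ∀ s → b + s + d * (2 * suc n + 1) ≡ b + (d * (2 * n + 1) + (s + 2 * d))
    arith s = solve (b ◂ s ◂ d ◂ n ◂ ∙)
  fresh : ∀ s → b + s + d * (2 * suc n + 1) ≡ b + M → ¬ SignedSum L (2 + j) (+ (b + s))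
  fresh s eq q with <-cmp b (d * (2 * suc n + 1))
  ... | tri≈ _ b≡ _ = b≢next b≡
  -- Now b + s exceeds M, the largest old sum.
  ... | tri> _ _ next<b = <⇒≱ (cancel-< M (b + s) 0 next<b (≡.trans (swap-sum M b) (sym eq))) (signed-bound desc q)
    where
    swap-sum : ∀ M b → M + b + 0 ≡ b + M
    swap-sum M b = solve (M ◂ b ◂ ∙)
  -- With `suc y` = d(2n + 3) - b, the value b + s lies `suc y` below M. This is less than 2d, too
  -- close for two old sums.
  ... | tri< b<next _ _ with m≤n⇒∃[o]m+o≡n b<next
  ... | y , b+y = <⇒≱ (cancel-< (suc y) (2 * d) 0 last<b (≡.trans (arith y) (≡.trans b+y (odd-step d n))))
        (signed-odds-gap {d} {suc n} {2 + j} q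
          (subst (λ v → SignedSum L (2 + j) (+ v)) (sym e+y) (signed-top (2 + j) len)) z<s)
    where
    arith : ∀ y → suc y + b + 0 ≡ suc b + y
    arith y = solve (y ◂ b ◂ ∙)
    odd-step : ∀ d n → d * (2 * suc n + 1) ≡ 2 * d + d * (2 * n + 1)
    odd-step d n = solve (d ◂ n ◂ ∙)
    regroup : ∀ s y → b + (b + s + suc y) ≡ b + s + (suc b + y)
    regroup s y = solve (b ◂ s ◂ y ◂ ∙)
    e+y : b + s + suc y ≡ M
    e+y = +-cancelˡ-≡ b _ _ (≡.trans (regroup s y) (≡.trans (cong (λ v → b + s + v) b+y) eq))

-- Induction on the number of elements for fixed h.

SignedDichotomy : ℕ → List ℕ → ℕ → Set
SignedDichotomy h L N =
  AtLeast (SignedSum L h) (suc N) ⊎ (∃ λ d → L ≡ odds d (length L) × AtLeast (SignedSum L h) N)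

-- With h = 3 + i and h + 1 + j elements: (h + 1)² from the punctured sums at j = 0, then 2h for
-- every further element.
signed-dichotomy : ∀ i j {L} → AllPairs _>_ L → All (0 <_) L → length L ≡ 4 + i + j →
  SignedDichotomy (3 + i) L ((4 + i) * (4 + i) + j * (2 * (3 + i)))
signed-dichotomy i zero {L} desc 0<L len = subst (SignedDichotomy (3 + i) L) (sym (+-identityʳ _)) base
  where
  len′ : length L ≡ 4 + i
  len′ = ≡.trans len (+-identityʳ _)
  base : SignedDichotomy (3 + i) L ((4 + i) * (4 + i))
  base with dichotomy i desc 0<L len′
  ... | inj₁ many = inj₁ (signed-many len′ many)
  ... | inj₂ (d , L≡ , full) = inj₂ (d , ≡.trans L≡ (cong (odds d) (sym len′)) , signed-many len′
    ( applyUpTo f ((4 + i) * (4 + i))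
    , AllPairsₚ.applyUpTo⁺₁ f _ (λ x<y _ → <⇒≢ (*-monoʳ-< d ⦃ >-nonZero 0<d ⦄ (+-monoˡ-< 1 (*-monoʳ-< 2 x<y))))
    , Allₚ.applyUpTo⁺₁ f _ (full _)
    , ≤-reflexive (sym (length-applyUpTo f _))))
    where
    f : ℕ → ℕ
    f x = d * (2 * x + 1)
    0<d : 0 < d
    0<d = odds-positive {d} {3 + i} (subst (All (0 <_)) L≡ 0<L)
signed-dichotomy i (suc j) {b ∷ L} desc@(b> ∷ desc′) (_ ∷ 0<L′) len =
  step (signed-dichotomy i j desc′ 0<L′ len′)
  where
  N = (4 + i) * (4 + i) + j * (2 * (3 + i))
  len′ : length L ≡ 4 + (i + j)
  len′ = suc-injective (≡.trans len (cong (λ n → 4 + n) (+-suc i j)))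
  enough : 3 + i ≤ length L
  enough = subst (3 + i ≤_) (sym len′) (≤-trans (m≤m+n (3 + i) j) (n≤1+n _))
  grow : ∀ {M} → AtLeast (SignedSum L (3 + i)) M → AtLeast (SignedSum (b ∷ L) (3 + i)) (M + ((3 + i) + (3 + i)))
  grow many = signed-extend many (transfer _≡_ (λ p → _ , proj₁ p , refl) (λ { refl refl h → h }) (exchanges (2 + i) desc enough))
  size : ∀ S h j → S + suc j * (2 * h) ≡ S + j * (2 * h) + (h + h)
  size S h j = solve (S ◂ h ◂ j ◂ ∙)
  N′≡ : (4 + i) * (4 + i) + suc j * (2 * (3 + i)) ≡ N + ((3 + i) + (3 + i))
  N′≡ = size ((4 + i) * (4 + i)) (3 + i) j
  step : SignedDichotomy (3 + i) L N → SignedDichotomy (3 + i) (b ∷ L) ((4 + i) * (4 + i) + suc j * (2 * (3 + i)))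
  step (inj₁ many) = inj₁ (AtLeast-weaken (≤-reflexive (cong suc N′≡)) (grow many))
  step (inj₂ (d , L≡ , many)) with b ≟ d * (2 * length L + 1)
  ... | yes b≡ = inj₂ (d , cong₂ _∷_ b≡ L≡ , AtLeast-weaken (≤-reflexive N′≡) (grow many))
  -- Off the progression there are h + 1 new positive values, so 2h + 2 new sums, where 2h + 1 are
  -- required.
  ... | no b≢ = inj₁ (AtLeast-weaken (≤-trans (≤-reflexive (cong suc N′≡)) (more N (3 + i)))
      (signed-extend many (subst (λ l → AtLeast (New b l (3 + i)) (4 + i)) (sym odds≡)
        (exchanges-odds (suc i) 0<d (s≤s (s≤s (s≤s (m≤m+n i j)))) (All.head (subst (All (_< b)) odds≡ b>))
          (subst (λ l → b ≢ d * (2 * l + 1)) len′ b≢)))))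
    where
    odds≡ : L ≡ odds d (4 + (i + j))
    odds≡ = ≡.trans L≡ (cong (odds d) len′)
    0<d : 0 < d
    0<d = odds-positive {d} {3 + (i + j)} (subst (All (0 <_)) odds≡ 0<L′)
    more : ∀ N h → suc (N + (h + h)) ≤ N + (suc h + suc h)
    more N h = subst (_≤ N + (suc h + suc h)) (+-suc N (h + h)) (+-monoʳ-≤ N (s≤s (+-monoʳ-≤ h (n≤1+n h))))

-- Passage to the enumerated sumset, and the conclusion.

signed⇒weighted : ∀ {k} (a : Vec ℕ k) {h z} → SignedSum (Vec.toList a) h z → (h , z) ∈ weightedSums (map (λ x → + x) a)
signed⇒weighted [] [] = here refl
signed⇒weighted (x ∷ a) (sgn s p) = ∈-concatMap⁺
  (λ s → List.map (λ q → absSign s + proj₁ q , applySign s (+ x) ℤ.+ proj₂ q) (weightedSums (map (λ x → + x) a)))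
  (choose s (∈-map⁺ _ (signed⇒weighted a p)))
  where
  choose : ∀ s {P : Sign → Set} → P s → Any P signs
  choose neg p = here p
  choose zer p = there (here p)
  choose pos p = there (there (here p))

signed⇒∈ : ∀ {k} (a : Vec ℕ k) {h z} → SignedSum (Vec.toList a) h z →
  z ∈ deduplicate ℤₚ._≟_ (restrictedSignedSumList h (map (λ x → + x) a))
signed⇒∈ a {h} p = ∈-deduplicate⁺ ℤₚ._≟_ (∈-map⁺ proj₂ (∈-filter⁺ (λ q → proj₁ q ≟ h) (signed⇒weighted a p) refl))

ascending : ∀ {k} (a : Vec ℕ k) → (∀ (i j : Fin k) → toℕ i < toℕ j → lookup a i < lookup a j) →
  AllPairs _<_ (Vec.toList a)
ascending [] _ = []
ascending (x ∷ a) inc = go a (λ j → inc zero (suc j) z<s) ∷ ascending a (λ i j i<j → inc (suc i) (suc j) (s≤s i<j))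
  where
  go : ∀ {k} (v : Vec ℕ k) → (∀ j → x < lookup v j) → All (x <_) (Vec.toList v)
  go [] _ = []
  go (y ∷ v) f = f zero ∷ go v (λ j → f (suc j))

lookup-applyUpTo : ∀ {k} (a : Vec ℕ k) f → Vec.toList a ≡ applyUpTo f k → ∀ i → lookup a i ≡ f (toℕ i)
lookup-applyUpTo (x ∷ a) f eq zero = proj₁ (∷-injective eq)
lookup-applyUpTo (x ∷ a) f eq (suc i) = lookup-applyUpTo a (f ∘ suc) (proj₂ (∷-injective eq)) i

AllPairs-reverse : {A : Set} {R : A → A → Set} {xs : List A} → AllPairs R xs → AllPairs (λ x y → R y x) (reverse xs)
AllPairs-reverse [] = []
AllPairs-reverse {xs = x ∷ xs} (h ∷ p) = subst (AllPairs _) (sym (unfold-reverse x xs))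
  (AllPairsₚ.++⁺ (AllPairs-reverse p) ([] ∷ [])
    (All.map (λ r → r ∷ []) (All-resp-↭ (↭-sym (↭-reverse xs)) h)))

-- A surplus of distinct signed sums would not fit into the deduplicated list. The vector is
-- reversed because the dichotomy works with descending lists.
extremal-progression : ∀ i j (a : Vec ℕ (4 + i + j)) → (∀ x → 0 < lookup a x) →
  (∀ (x y : Fin (4 + i + j)) → toℕ x < toℕ y → lookup a x < lookup a y) →
  restrictedSignedSumsetSize (3 + i) (map +_ a) ≡ (4 + i) * (4 + i) + j * (2 * (3 + i)) →
  ∃ λ d → Vec.toList a ≡ applyUpTo (λ x → d * (2 * x + 1)) (4 + i + j)
extremal-progression i j a 0<a inc size
  with signed-dichotomy i j (AllPairs-reverse (ascending a inc))
         (All-resp-↭ (↭-sym (↭-reverse (Vec.toList a))) (positive a 0<a))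
         (≡.trans (length-reverse (Vec.toList a)) (Vecₚ.length-toList a))
  where
  positive : ∀ {k} (v : Vec ℕ k) → (∀ x → 0 < lookup v x) → All (0 <_) (Vec.toList v)
  positive [] _ = []
  positive (x ∷ v) f = f zero ∷ positive v (λ y → f (suc y))
... | inj₁ (l , u , ps , N<) = contradiction (≤-trans N< (Unique-length u
        (All.map (λ p → signed⇒∈ a (signed-↭ (↭-reverse (Vec.toList a)) p)) ps))) (<⇒≱ (s≤s (≤-reflexive size)))
... | inj₂ (d , L≡ , _) = d , (begin
    Vec.toList a                        ≡⟨ reverse-involutive (Vec.toList a) ⟨
    reverse (reverse (Vec.toList a))    ≡⟨ cong reverse L≡ ⟩
    reverse (odds d n)                  ≡⟨ reverse-applyDownFrom (λ x → d * (2 * x + 1)) n ⟩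
    applyUpTo (λ x → d * (2 * x + 1)) n ≡⟨ cong (applyUpTo (λ x → d * (2 * x + 1))) (≡.trans (length-reverse (Vec.toList a)) (Vecₚ.length-toList a)) ⟩
    applyUpTo (λ x → d * (2 * x + 1)) (4 + i + j) ∎)
  where
  open ≡-Reasoning
  n = length (reverse (Vec.toList a))

theorem2 : (h k : ℕ) → 3 ≤ h → h ≤ k ∸ 1 → (a : Vec ℕ k) →
    (∀ i → 0 ℕ.< lookup a i) →
    (∀ (i j : Fin k) → toℕ i ℕ.< toℕ j → lookup a i ℕ.< lookup a j) →
    restrictedSignedSumsetSize h (map +_ a) ≡ (2 ℕ.* h ℕ.* k ∸ h ℕ.* h) ℕ.+ 1 →
    ∀ (i₀ i : Fin k) → toℕ i₀ ≡ 0 → lookup a i ≡ lookup a i₀ ℕ.* (2 ℕ.* toℕ i ℕ.+ 1)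
theorem2 h zero 3≤h h≤0 = contradiction (≤-trans 3≤h h≤0) λ ()
-- Writes h = 3 + i and the number of elements as h + 1 + j.
theorem2 h (suc k) 3≤h h≤k with m≤n⇒∃[o]m+o≡n 3≤h | m≤n⇒∃[o]m+o≡n h≤k
... | i , refl | j , refl = λ a 0<a inc size i₀ x i₀≡0 →
  let d , eq = extremal-progression i j a 0<a inc (≡.trans size (count (3 + i) j))
      a≡ = lookup-applyUpTo a (λ x → d * (2 * x + 1)) eq
      first : lookup a i₀ ≡ d
      first = ≡.trans (a≡ i₀) (≡.trans (cong (λ n → d * (2 * n + 1)) i₀≡0) (*-identityʳ d))
  in ≡.trans (a≡ x) (cong (_* (2 * toℕ x + 1)) (sym first))
  where
  -- The truncated subtraction is exact, as 2h(h + 1 + j) contains the summand h².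
  count : ∀ h j → (2 * h * (suc h + j) ∸ h * h) + 1 ≡ suc h * suc h + j * (2 * h)
  count h j = begin
    (2 * h * (suc h + j) ∸ h * h) + 1                       ≡⟨ cong (λ n → (n ∸ h * h) + 1) expand ⟩
    (h * h + (h * h + 2 * h + j * (2 * h)) ∸ h * h) + 1     ≡⟨ cong (λ n → n + 1) (m+n∸m≡n (h * h) _) ⟩
    h * h + 2 * h + j * (2 * h) + 1                         ≡⟨ solve (h ◂ j ◂ ∙) ⟩
    suc h * suc h + j * (2 * h)                             ∎
    where
    open ≡-Reasoning
    expand : 2 * h * (suc h + j) ≡ h * h + (h * h + 2 * h + j * (2 * h))
    expand = solve (h ◂ j ◂ ∙)
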